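{- There are absolute constants $c>0$ and $C>0$ such that for every $N \in \mathbb{N}$, every set $A \subset \mathbb{F}_2^\infty$ of size $|A|=N$, and every $k \in \mathbb{N}$ with $k \geq C N^{1-c}$, the set $A$ is $k$-stable (in $\mathbb{F}_2^\infty$). (That is, every $A \subset \mathbb{F}_2^\infty$ of size $N$ is $O(N^{1-c})$-stable.)
   Context: $\mathbb{N}=\{1,2,3,\dots\}$. $\mathbb{F}_2^\infty$ denotes the direct sum of countably many copies of $\mathbb{F}_2$, regarded as an additive Abelian group. Let $G$ be an Abelian group, $A \subset G$ and $k \in \mathbb{N}$. The set $A$ has the $k$-order property (in $G$) if there are vectors $s=(s_1,\dots,s_k)$ and $t=(t_1,\dots,t_k)$ in $G^k$ such that for all $1 \leq i,j \leq k$ one has $s_i+t_j \in A$ if and only if $i \leq j$. The set $A$ is $k$-stable (in $G$) if it does not have the $k$-order property. -}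

module Defs where

open import Algebra.Bundles using (AbelianGroup; CommutativeRing)
import Algebra.Construct.Pointwise as Pointwise
import Algebra.Properties.AbelianGroup as AbelianGroupProperties
import Algebra.Properties.Semiring.Exp as SemiringExp
open import Data.Fin.Base as Fin using (Fin)
open import Data.Integer.Base as ℤ using (ℤ; +_; -[1+_])
open import Data.Nat.Base as ℕ using (ℕ; suc)
open import Data.Nat.Properties using (m^n≢0; m⊔n≤o⇒m≤o; m⊔n≤o⇒n≤o)
open import Data.Parity.Properties using (+-0-abelianGroup)
open import Data.Product.Base using (Σ; ∃; ∃-syntax; _,_; proj₁; proj₂)
open import Data.Rational.Base as ℚ using (ℚ; ↥_; ↧ₙ_)
open import Data.Rational.Properties using (+-*-commutativeRing)
open import Data.Vec.Functional using (Vector)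
open import Function.Bundles using (_⇔_; Bijection)
open import Level using (Level; 0ℓ; _⊔_)
open import Relation.Binary.Bundles using (Setoid)
import Relation.Binary.Construct.On as On
open import Relation.Binary.PropositionalEquality.Properties using (setoid)
open import Relation.Nullary.Negation.Core using (¬_)
open import Relation.Unary using (Pred; _∈_)

private
  variable
    a ℓ p : Level

module _ (G : AbelianGroup a ℓ) where

  open AbelianGroup G

  FiniteSupport : Pred (ℕ → Carrier) ℓ
  FiniteSupport f = ∃[ n ] (∀ i → n ℕ.≤ i → f i ≈ ε)

  -- The direct sum of copies of G indexed by ℕ.  Equality is pointwise: the
  -- support bound carried by an element plays no part in it.
  ⨁ℕ : AbelianGroup (a ⊔ ℓ) ℓ
  ⨁ℕ = record
    { Carrier = Σ (ℕ → Carrier) FiniteSupport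
    ; _≈_     = λ x y → proj₁ x P.≈ proj₁ y
    ; _∙_     = λ (f , m , f≈ε) (g , n , g≈ε) →
                  (f P.∙ g) , (m ℕ.⊔ n) , λ i m⊔n≤i →
                    trans (∙-cong (f≈ε i (m⊔n≤o⇒m≤o m n m⊔n≤i))
                                  (g≈ε i (m⊔n≤o⇒n≤o m n m⊔n≤i)))
                          (identityˡ ε)
    ; ε       = P.ε , 0 , λ _ _ → refl
    ; _⁻¹     = λ (f , m , f≈ε) →
                  (f P.⁻¹) , m , λ i m≤i →
                    trans (⁻¹-cong (f≈ε i m≤i)) ε⁻¹≈ε
    ; isAbelianGroup = record
      { isGroup = record
        { isMonoid = record
          { isSemigroup = record
            { isMagma = record
              { isEquivalence = On.isEquivalence proj₁ P.isEquivalence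
              ; ∙-cong        = P.∙-cong
              }
            ; assoc = λ x y z → P.assoc (proj₁ x) (proj₁ y) (proj₁ z)
            }
          ; identity = (λ x → P.identityˡ (proj₁ x))
                     , (λ x → P.identityʳ (proj₁ x))
          }
        ; inverse = (λ x → P.inverseˡ (proj₁ x))
                  , (λ x → P.inverseʳ (proj₁ x))
        ; ⁻¹-cong = P.⁻¹-cong
        }
      ; comm = λ x y → P.comm (proj₁ x) (proj₁ y)
      }
    }
    where
    module P = AbelianGroup (Pointwise.abelianGroup ℕ G)
    open AbelianGroupProperties G using (ε⁻¹≈ε)

  HasOrderProperty : ℕ → Pred Carrier p → Set (a ⊔ p)
  HasOrderProperty k A =
    ∃ λ (s : Vector Carrier k) → ∃ λ (t : Vector Carrier k) →
      ∀ i j → (s i ∙ t j ∈ A) ⇔ (i Fin.≤ j)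

  Stable : ℕ → Pred Carrier p → Set (a ⊔ p)
  Stable k A = ¬ HasOrderProperty k A

𝔽₂^∞ : AbelianGroup 0ℓ 0ℓ
𝔽₂^∞ = ⨁ℕ +-0-abelianGroup

-- Elements of A are counted up to the setoid equality, and membership proofs
-- are not distinguished.
HasSize : (S : Setoid a ℓ) → Pred (Setoid.Carrier S) p → ℕ → Set (a ⊔ ℓ ⊔ p)
HasSize S A n =
  Bijection (setoid (Fin n)) (On.setoid S (proj₁ {B = λ x → x ∈ A}))

infixr 8 _^ᶻ_

_^ᶻ_ : (n : ℕ) .{{_ : ℕ.NonZero n}} → ℤ → ℚ
n ^ᶻ (+ m)    = + (n ℕ.^ m) ℚ./ 1
n ^ᶻ -[1+ m ] = ℚ._/_ (+ 1) (n ℕ.^ suc m) {{m^n≢0 n (suc m)}}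

open SemiringExp (CommutativeRing.semiring +-*-commutativeRing)
  using (_^_)

-- For C ≥ 0 and r = u / v in lowest terms, the real inequality k ≥ C · N^r is
-- stated by raising both (nonnegative) sides to the power v ≥ 1, which clears
-- the root:  k^v ≥ C^v · N^u.
_≥[_·_^_] : ℕ → ℚ → (N : ℕ) .{{_ : ℕ.NonZero N}} → ℚ → Set
k ≥[ C · N ^ r ] =
  (+ k ℚ./ 1) ^ ↧ₙ r ℚ.≥ (C ^ ↧ₙ r) ℚ.* (N ^ᶻ ↥ r)

{-# OPTIONS --safe #-}

-- Suppose s i + t j ∈ A exactly when i ≤ j, and cut the indices into three
-- consecutive blocks of length n, so that s₁ + t₂, s₁ + t₃ and s₂ + t₃ all lie in A.
-- Two observations meet in the middle block.
--
-- In characteristic 2, s i + t j = s l + t l forces i ≤ l ≤ j, because then also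
-- s i + t l = s l + t j.  So (s i , t i , s i + t i) is an ordered version of a
-- tri-coloured sum-free set, and the polynomial method bounds the number of indices
-- in 𝔽₂^m by three times the number of monomials of degree at most m / 3.
--
-- If A has size N not much larger than n, then for popular u and v half of the
-- middle indices l are such that s l + t u and s v + t l have many representations
-- in s₂ + t₃ and s₁ + t₂.  Writing s i + t j + s l + t l + s v + t u in many ways as a
-- sum of five elements of A bounds the number of such sums by O(N⁷ / n⁶), so a linear
-- map to a space of about that size has no nonzero s i + t j + s l + t l in its kernel
-- and preserves the ordering property.  Comparing the two bounds gives n⁸⁵ = O(N⁸⁴).

module Submission where

open import Defs
open import Algebra.Bundles using (AbelianGroup; CommutativeRing)
import Algebra.Properties.Semiring.Exp as SemiringExp
import Algebra.Properties.Semiring.Sum as SemiringSum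
open import Algebra.Solver.Ring.AlmostCommutativeRing using (fromCommutativeRing)
import Algebra.Solver.Ring.Simple as RingSolver
open import Data.Fin.Base as Fin using (Fin; zero; suc; _↑ˡ_; _↑ʳ_; combine; remQuot; inject≤)
import Data.Fin.Properties as Fin
import Data.Integer.Base as ℤ
import Data.Integer.Properties as ℤ
open import Data.List.Base as List using (List; []; _∷_; _++_; length)
import Data.List.Membership.DecPropositional as DecMembership
open import Data.List.Membership.Propositional using (_∈_; _∉_)
open import Data.List.Membership.Propositional.Properties
  using (∈-lookup; ∈-filter⁺; ∈-tabulate⁺; ∈-tabulate⁻; ∈-deduplicate⁺; ∈-deduplicate⁻)
import Data.List.Properties as List
open import Data.List.Relation.Unary.All as All using (All; []; _∷_)
import Data.List.Relation.Unary.All.Properties as All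
open import Data.List.Relation.Unary.AllPairs using (_∷_)
open import Data.List.Relation.Unary.Any as Any using (here; there)
import Data.List.Relation.Unary.Any.Properties as Any
open import Data.List.Relation.Unary.Unique.DecPropositional.Properties using (deduplicate-!)
open import Data.List.Relation.Unary.Unique.Propositional using (Unique)
open import Data.Nat.Base as ℕ
  using (ℕ; zero; suc; pred; _+_; _*_; _^_; _≤_; z≤n; s≤s; NonZero)
open import Data.Nat.Coprimality using (1-coprimeTo) renaming (sym to coprime-sym)
import Data.Nat.DivMod as ℕ
import Data.Nat.Properties as ℕ
open import Data.Nat.Tactic.RingSolver using (solve-∀)
open import Data.Parity.Base as ℙ using (Parity; 0ℙ; 1ℙ)
  renaming (_+_ to infixl 6 _⊕_; _*_ to infixl 7 _⊗_)
import Data.Parity.Properties as ℙ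
open import Data.Product.Base using (∃-syntax; _×_; _,_; proj₁; proj₂; uncurry)
open import Data.Product.Function.NonDependent.Propositional using (_×-↔_)
open import Data.Product.Properties using (,-injective)
open import Data.Rational.Base as ℚ using (ℚ; 0ℚ; 1ℚ; mkℚ; _<_; _-_)
import Data.Rational.Properties as ℚ
open import Data.Sum.Base using (_⊎_; inj₁; inj₂)
open import Data.Vec.Base as Vec using (Vec; []; _∷_; head; tail)
import Data.Vec.Properties as Vec
open import Function.Base using (_∘_; flip)
open import Function.Bundles
  using (_↔_; mk↣; Bijection; module Equivalence; module Injection; module Inverse)
open import Function.Construct.Composition using (_↣-∘_; _↔-∘_)
open import Function.Construct.Identity using (↔-id)
open import Function.Construct.Symmetry using (↔-sym)
open import Function.Definitions using (Injective)
open import Function.Properties.Inverse using (↔⇒↣)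
open import Level using (0ℓ)
open import Relation.Binary.Definitions using (_Respects_; tri<; tri≈; tri>)
open import Relation.Binary.PropositionalEquality
  using (_≡_; _≢_; refl; sym; trans; cong; cong₂; subst; subst₂; module ≡-Reasoning)
open import Relation.Nullary using (¬_; Dec; yes; no; contradiction; ¬?; _×-dec_)
open import Relation.Nullary.Decidable using (decidable-stable; from-yes)
open import Relation.Unary using (Pred)

module Σℕ = SemiringSum ℕ.+-*-semiring
open SemiringSum ℙ.+-*-semiring
  using (sum; sum-cong-≗; ∑-distrib-+; *-distribˡ-sum; *-distribʳ-sum)
open SemiringExp (CommutativeRing.semiring ℚ.+-*-commutativeRing)
  using () renaming (_^_ to infixr 8 _^ℚ_)
module ℙ-Solver =
  RingSolver (fromCommutativeRing ℙ.+-*-commutativeRing) ℙ._≟_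
open ℙ-Solver using (solve; _:+_; _:*_; _:=_; con)

private
  variable
    D k m n N : ℕ

-- Linear algebra and the three-coloured bound over 𝔽₂

sum-zero : (f : Fin k → Parity) → (∀ i → f i ≡ 0ℙ) → sum f ≡ 0ℙ
sum-zero {zero}  f f≡0 = refl
sum-zero {suc k} f f≡0 = cong₂ _⊕_ (f≡0 zero) (sum-zero (f ∘ suc) (f≡0 ∘ suc))

sum-single : (p : Fin k) (f : Fin k → Parity) → (∀ i → i ≢ p → f i ≡ 0ℙ) → sum f ≡ f p
sum-single zero f f≡0 =
  trans (cong (f zero ⊕_) (sum-zero (f ∘ suc) (λ i → f≡0 (suc i) λ ()))) (ℙ.+-identityʳ (f zero))
sum-single (suc p) f f≡0 =
  cong₂ _⊕_ (f≡0 zero λ ())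
    (sum-single p (f ∘ suc) (λ i i≢p → f≡0 (suc i) (i≢p ∘ Fin.suc-injective)))

dot : (u f : Fin k → Parity) → Parity
dot u f = sum (λ i → u i ⊗ f i)

dot-+ˡ : (u v f : Fin k → Parity) → dot (λ i → u i ⊕ v i) f ≡ dot u f ⊕ dot v f
dot-+ˡ u v f = trans (sum-cong-≗ (λ i → ℙ.*-distribʳ-+ (f i) (u i) (v i)))
                     (∑-distrib-+ (λ i → u i ⊗ f i) (λ i → v i ⊗ f i))

dot-+ʳ : (u f g : Fin k → Parity) → dot u (λ i → f i ⊕ g i) ≡ dot u f ⊕ dot u g
dot-+ʳ u f g = trans (sum-cong-≗ (λ i → ℙ.*-distribˡ-+ (u i) (f i) (g i)))
                     (∑-distrib-+ (λ i → u i ⊗ f i) (λ i → u i ⊗ g i))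

dot-*ʳ : ∀ a (u f : Fin k → Parity) → dot u (λ i → a ⊗ f i) ≡ a ⊗ dot u f
dot-*ʳ a u f = trans
  (sum-cong-≗ (λ i → solve 3 (λ a u f → u :* (a :* f) := a :* (u :* f)) refl a (u i) (f i)))
  (sym (*-distribˡ-sum a (λ i → u i ⊗ f i)))

single : Fin k → Parity → Fin k → Parity
single p a i with i Fin.≟ p
... | yes _ = a
... | no  _ = 0ℙ

single-≡ : (p : Fin k) (a : Parity) → single p a p ≡ a
single-≡ p a with p Fin.≟ p
... | yes _   = refl
... | no  p≢p = contradiction refl p≢p

single-≢ : {p i : Fin k} (a : Parity) → i ≢ p → single p a i ≡ 0ℙ
single-≢ {p = p} {i} a i≢p with i Fin.≟ p
... | yes i≡p = contradiction i≡p i≢p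
... | no  _   = refl

dot-single : (p : Fin k) (a : Parity) (f : Fin k → Parity) → dot (single p a) f ≡ a ⊗ f p
dot-single p a f = trans
  (sum-single p _ (λ i i≢p → cong (_⊗ f i) (single-≢ a i≢p)))
  (cong (_⊗ f p) (single-≡ p a))

-- The order stays abstract because elimination is run both for `<` and for `>`: solutions are
-- wanted that vanish before p, and others that vanish after p.
module _ {k} (_≺_ : Fin k → Fin k → Set)
  (≺-cotrans : ∀ {i j} → i ≺ j → ∀ l → i ≺ l ⊎ l ≺ j)
  (≺-last : ∀ (f : Fin k → Parity) →
     (∀ i → f i ≡ 0ℙ) ⊎ ∃[ p ] (f p ≡ 1ℙ × ∀ i → p ≺ i → f i ≡ 0ℙ))
  where

  Leading : Fin k → (Fin k → Parity) → Set
  Leading p u = u p ≡ 1ℙ × (∀ i → i ≺ p → u i ≡ 0ℙ)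

  -- Gaussian elimination: each equation disqualifies at most one position, its
  -- ≺-last pivot.
  leading-solutions : (fs : List (Fin k → Parity)) →
    ∃[ bad ] (length bad ≤ length fs ×
      (∀ p → p ∉ bad → ∃[ u ] (Leading p u × All (λ f → dot u f ≡ 0ℙ) fs)))
  leading-solutions fs = go (length fs) fs refl
    where
    -- Recursion is on the number of equations, since elimination rewrites the remaining ones
    -- instead of passing to a sublist.
    go : ∀ n fs → length fs ≡ n →
      ∃[ bad ] (length bad ≤ length fs ×
        (∀ p → p ∉ bad → ∃[ u ] (Leading p u × All (λ f → dot u f ≡ 0ℙ) fs)))
    go zero [] eq = [] , z≤n , λ p _ →
      single p 1ℙ ,
      (single-≡ p 1ℙ , λ i i≺p → single-leading p i i≺p) , []
      where
      single-leading : ∀ p i → i ≺ p → single p 1ℙ i ≡ 0ℙ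
      single-leading p i i≺p with i Fin.≟ p
      ... | no  _ = refl
      -- Here `i ≺ i`. This is impossible: the `≺`-last nonzero position of `single i 1ℙ` can only
      -- be i, and the value there would then have to vanish.
      ... | yes refl with ≺-last (single i 1ℙ)
      ...   | inj₁ z = contradiction (trans (sym (single-≡ i 1ℙ)) (z i)) λ ()
      ...   | inj₂ (q , fq , z) with q Fin.≟ i
      ...     | yes refl = trans (sym (single-≡ q 1ℙ)) (z q i≺p)
      ...     | no q≢i   = contradiction fq λ ()
    go (suc n) (f ∷ fs) eq with ≺-last f
    ... | inj₁ f≡0 =
      let bad , bad≤ , sol = go n fs (ℕ.suc-injective eq) in
      bad , ℕ.≤-trans bad≤ (ℕ.n≤1+n _) , λ p p∉ →
        let u , lead , u⊥fs = sol p p∉ in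
        u , lead ,
        sum-zero _ (λ i → trans (cong (u i ⊗_) (f≡0 i)) (ℙ.*-zeroʳ (u i))) ∷ u⊥fs
    ... | inj₂ (q , fq≡1 , f≡0) =
      let bad , bad≤ , sol = go n (List.map reduce fs)
                                (trans (List.length-map reduce fs) (ℕ.suc-injective eq)) in
      q ∷ bad , s≤s (subst (length bad ≤_) (List.length-map reduce fs) bad≤) , λ p p∉ →
        let u , (up≡1 , u≡0) , u⊥fs = sol p (p∉ ∘ there)
            -- Changing u at the pivot q by c makes it orthogonal to f, because f is 1 there. The
            -- same change turns orthogonality to `reduce g` into orthogonality to g.
            c = dot u f
            u′ = λ i → u i ⊕ single q c i
            dot-u′ : ∀ g → dot u′ g ≡ dot u g ⊕ c ⊗ g q
            dot-u′ g = trans (dot-+ˡ u (single q c) g) (cong (dot u g ⊕_) (dot-single q c g))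
            u′⊥f : dot u′ f ≡ 0ℙ
            u′⊥f = trans (dot-u′ f) (trans (cong (λ a → c ⊕ c ⊗ a) fq≡1)
                     (solve 1 (λ c → c :+ c :* con 1ℙ := con 0ℙ) refl c))
            u′⊥ : ∀ {g} → dot u (reduce g) ≡ 0ℙ → dot u′ g ≡ 0ℙ
            u′⊥ {g} u⊥g = begin
              dot u′ g              ≡⟨ dot-u′ g ⟩
              dot u g ⊕ c ⊗ g q     ≡⟨ cong (dot u g ⊕_) (ℙ.*-comm c (g q)) ⟩
              dot u g ⊕ g q ⊗ c     ≡⟨ cong (dot u g ⊕_) (dot-*ʳ (g q) u f) ⟨
              dot u g ⊕ dot u (λ i → g q ⊗ f i) ≡⟨ dot-+ʳ u g (λ i → g q ⊗ f i) ⟨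
              dot u (reduce g)      ≡⟨ u⊥g ⟩
              0ℙ                    ∎
        in
        u′ ,
        ( cong₂ _⊕_ up≡1 (single-≢ c (p∉ ∘ here))
        , λ i i≺p → cong₂ _⊕_ (u≡0 i i≺p) (single≡0 u p u≡0 i i≺p)) ,
        u′⊥f ∷ All.map u′⊥ (All.map⁻ u⊥fs)
      where
      open ≡-Reasoning
      reduce : (Fin k → Parity) → (Fin k → Parity)
      reduce g i = g i ⊕ g q ⊗ f i

      -- The correction at q is harmless even if `q ≺ p`: every l then lies after q, where f
      -- vanishes, or before p, where u vanishes, so the correction `dot u f` is itself zero.
      single≡0 : ∀ u p → (∀ i → i ≺ p → u i ≡ 0ℙ) → ∀ i → i ≺ p → single q (dot u f) i ≡ 0ℙ
      single≡0 u p u≡0 i i≺p with i Fin.≟ q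
      ... | no  _    = refl
      ... | yes refl = sum-zero _ vanish
        where
        vanish : ∀ l → u l ⊗ f l ≡ 0ℙ
        vanish l with ≺-cotrans i≺p l
        ... | inj₁ q≺l = trans (cong (u l ⊗_) (f≡0 l q≺l)) (ℙ.*-zeroʳ (u l))
        ... | inj₂ l≺p = cong (_⊗ f l) (u≡0 l l≺p)

<-last : (f : Fin k → Parity) →
  (∀ i → f i ≡ 0ℙ) ⊎ ∃[ p ] (f p ≡ 1ℙ × ∀ i → p Fin.< i → f i ≡ 0ℙ)
<-last {zero}  f = inj₁ λ ()
<-last {suc k} f with <-last (f ∘ suc)
... | inj₂ (p , fp , z) = inj₂ (suc p , fp , λ { (suc i) (s≤s p<i) → z i p<i })
... | inj₁ z with f zero in eq
...   | 0ℙ = inj₁ λ { zero → eq ; (suc i) → z i }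
...   | 1ℙ = inj₂ (zero , eq , λ { (suc i) _ → z i })

>-last : (f : Fin k → Parity) →
  (∀ i → f i ≡ 0ℙ) ⊎ ∃[ p ] (f p ≡ 1ℙ × ∀ i → i Fin.< p → f i ≡ 0ℙ)
>-last {zero}  f = inj₁ λ ()
>-last {suc k} f with f zero in eq
... | 1ℙ = inj₂ (zero , eq , λ _ ())
... | 0ℙ with >-last (f ∘ suc)
...   | inj₂ (p , fp , z) = inj₂ (suc p , fp , λ { zero _ → eq ; (suc i) (s≤s i<p) → z i i<p })
...   | inj₁ z = inj₁ λ { zero → eq ; (suc i) → z i }

<-cotrans : {i j : Fin k} → i Fin.< j → (l : Fin k) → i Fin.< l ⊎ l Fin.< j
<-cotrans {i = i} i<j l with i Fin.<? l
... | yes i<l = inj₁ i<l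
... | no  i≮l = inj₂ (ℕ.≤-<-trans (ℕ.≮⇒≥ i≮l) i<j)

>-cotrans : {i j : Fin k} → j Fin.< i → (l : Fin k) → l Fin.< i ⊎ j Fin.< l
>-cotrans j<i l with <-cotrans j<i l
... | inj₁ j<l = inj₂ j<l
... | inj₂ l<i = inj₁ l<i

∃-∉ : (xs : List (Fin k)) → length xs ℕ.< k → ∃[ p ] p ∉ xs
∃-∉ xs xs<k = Fin.¬∀⟶∃¬ _ (_∈ xs) (_∈? xs) λ all∈ →
  ℕ.<⇒≱ xs<k (Fin.injective⇒≤ {f = λ p → Any.index (all∈ p)} λ {p} {q} eq →
    trans (Any.lookup-index (all∈ p))
          (trans (cong (List.lookup xs) eq) (sym (Any.lookup-index (all∈ q)))))
  where open DecMembership Fin._≟_ using (_∈?_)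

-- The values at the points s i of the monomials of degree below a.
monomials : ∀ m (a : ℕ) → (Fin k → Vec Parity m) → List (Fin k → Parity)
monomials zero    zero    s = []
monomials zero    (suc a) s = (λ _ → 1ℙ) ∷ []
monomials (suc m) a       s =
  monomials m a (tail ∘ s) ++
  List.map (λ f i → head (s i) ⊗ f i) (monomials m (pred a) (tail ∘ s))

#monomials : ℕ → ℕ → ℕ
#monomials zero    zero    = 0
#monomials zero    (suc a) = 1
#monomials (suc m) a       = #monomials m a + #monomials m (pred a)

length-monomials : ∀ m a (s : Fin k → Vec Parity m) → length (monomials m a s) ≡ #monomials m a
length-monomials zero    zero    s = refl
length-monomials zero    (suc a) s = refl
length-monomials (suc m) a       s = trans
  (List.length-++ (monomials m a (tail ∘ s)))
  (cong₂ _+_ (length-monomials m a (tail ∘ s))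
    (trans (List.length-map _ (monomials m (pred a) (tail ∘ s)))
           (length-monomials m (pred a) (tail ∘ s))))

-- The indicator of s + t = x as a product of linear factors.
indicator : ∀ m (s t x : Vec Parity m) → Parity
indicator zero    s t x = 1ℙ
indicator (suc m) s t x =
  (1ℙ ⊕ head s ⊕ head t ⊕ head x) ⊗ indicator m (tail s) (tail t) (tail x)

infixl 6 _⊞_
_⊞_ : Vec Parity m → Vec Parity m → Vec Parity m
_⊞_ = Vec.zipWith _⊕_

indicator-sum : (s t : Vec Parity m) → indicator m s t (s ⊞ t) ≡ 1ℙ
indicator-sum []      []      = refl
indicator-sum (a ∷ s) (b ∷ t) = cong₂ _⊗_
  (solve 2 (λ a b → con 1ℙ :+ a :+ b :+ (a :+ b) := con 1ℙ) refl a b)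
  (indicator-sum s t)

indicator≡1⇒ : (s t x : Vec Parity m) → indicator m s t x ≡ 1ℙ → s ⊞ t ≡ x
indicator≡1⇒ []      []      []      _  = refl
indicator≡1⇒ (a ∷ s) (b ∷ t) (c ∷ x) eq with 1ℙ ⊕ a ⊕ b ⊕ c in eq′
... | 1ℙ = cong₂ _∷_
  (trans (solve 3 (λ a b c → a :+ b := con 1ℙ :+ (con 1ℙ :+ a :+ b :+ c) :+ c) refl a b c)
         (cong (λ d → 1ℙ ⊕ d ⊕ c) eq′))
  (indicator≡1⇒ s t x eq)

module _ {k : ℕ} where

  sum³ : (Fin k → Fin k → Fin k → Parity) → Parity
  sum³ f = sum (λ i → sum (λ j → sum (f i j)))

  sum³-cong : ∀ {f g} → (∀ i j l → f i j l ≡ g i j l) → sum³ f ≡ sum³ g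
  sum³-cong eq = sum-cong-≗ λ i → sum-cong-≗ λ j → sum-cong-≗ (eq i j)

  sum³-+ : ∀ f g → sum³ (λ i j l → f i j l ⊕ g i j l) ≡ sum³ f ⊕ sum³ g
  sum³-+ f g = trans
    (sum-cong-≗ λ i → trans (sum-cong-≗ λ j → ∑-distrib-+ (f i j) (g i j))
                            (∑-distrib-+ (sum ∘ f i) (sum ∘ g i)))
    (∑-distrib-+ (λ i → sum (sum ∘ f i)) (λ i → sum (sum ∘ g i)))

  sum³-product : ∀ (u v w : Fin k → Parity) →
    sum³ (λ i j l → u i ⊗ (v j ⊗ w l)) ≡ sum u ⊗ (sum v ⊗ sum w)
  sum³-product u v w = begin
    sum (λ i → sum (λ j → sum (λ l → u i ⊗ (v j ⊗ w l))))
      ≡⟨ sum-cong-≗ (λ i → sum-cong-≗ λ j → trans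
           (sym (*-distribˡ-sum (u i) (λ l → v j ⊗ w l)))
           (cong (u i ⊗_) (sym (*-distribˡ-sum (v j) w)))) ⟩
    sum (λ i → sum (λ j → u i ⊗ (v j ⊗ sum w)))
      ≡⟨ sum-cong-≗ (λ i → trans
           (sym (*-distribˡ-sum (u i) (λ j → v j ⊗ sum w)))
           (cong (u i ⊗_) (sym (*-distribʳ-sum (sum w) v)))) ⟩
    sum (λ i → u i ⊗ (sum v ⊗ sum w))
      ≡⟨ *-distribʳ-sum (sum v ⊗ sum w) u ⟨
    sum u ⊗ (sum v ⊗ sum w) ∎
    where open ≡-Reasoning

  trilinear : ∀ m (u v w : Fin k → Parity) (s t x : Fin k → Vec Parity m) → Parity
  trilinear m u v w s t x =
    sum³ λ i j l → u i ⊗ (v j ⊗ (w l ⊗ indicator m (s i) (t j) (x l)))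

  infix 4 _⊥_
  _⊥_ : (Fin k → Parity) → List (Fin k → Parity) → Set
  u ⊥ fs = All (λ f → dot u f ≡ 0ℙ) fs

  ⊥-monomials-tail : ∀ {m} a {u} (s : Fin k → Vec Parity (suc m)) →
    u ⊥ monomials (suc m) a s → u ⊥ monomials m a (tail ∘ s)
  ⊥-monomials-tail {m} a s = All.++⁻ˡ (monomials m a (tail ∘ s))

  ⊥-monomials-head : ∀ {m} a {u} (s : Fin k → Vec Parity (suc m)) →
    u ⊥ monomials (suc m) a s →
    (λ i → u i ⊗ head (s i)) ⊥ monomials m (pred a) (tail ∘ s)
  ⊥-monomials-head {m} a {u} s u⊥ =
    All.map (λ {f} eq → trans (sum-cong-≗ λ i → ℙ.*-assoc (u i) (head (s i)) (f i)) eq)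
      (All.map⁻ (All.++⁻ʳ (monomials m a (tail ∘ s)) u⊥))

  private
    ones : ∀ a {u} (s : Fin k → Vec Parity 0) → 0 ℕ.< a → u ⊥ monomials 0 a s → sum u ≡ 0ℙ
    ones (suc a) {u} s _ (eq ∷ _) = trans (sum-cong-≗ λ i → sym (ℙ.*-identityʳ (u i))) eq

    -- For positive a both sides drop by one; at a = 0, where `pred` is truncated, only the left
    -- side drops.
    pred-bound : ∀ {m} a {b} → suc m ℕ.< a + b → m ℕ.< pred a + b
    pred-bound zero    lt = ℕ.<-trans (ℕ.n<1+n _) lt
    pred-bound (suc a) (s≤s lt) = lt

  -- Each of the m linear factors of the indicator contributes to the degree in
  -- at most one of the three variables, so every monomial of the product has
  -- degree below a in s, below b in t or below c in x.
  trilinear-vanishes : ∀ m a b c {u v w} (s t x : Fin k → Vec Parity m) →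
    m ℕ.< a + b + c →
    u ⊥ monomials m a s → v ⊥ monomials m b t → w ⊥ monomials m c x →
    trilinear m u v w s t x ≡ 0ℙ
  trilinear-vanishes zero a b c {u} {v} {w} s t x lt u⊥ v⊥ w⊥ = begin
    trilinear 0 u v w s t x
      ≡⟨ sum³-cong (λ i j l → cong (λ z → u i ⊗ (v j ⊗ z)) (ℙ.*-identityʳ (w l))) ⟩
    sum³ (λ i j l → u i ⊗ (v j ⊗ w l)) ≡⟨ sum³-product u v w ⟩
    sum u ⊗ (sum v ⊗ sum w)            ≡⟨ product≡0 a b c lt u⊥ v⊥ w⊥ ⟩
    0ℙ                                 ∎
    where
    open ≡-Reasoning
    product≡0 : ∀ a b c → 0 ℕ.< a + b + c →
      u ⊥ monomials 0 a s → v ⊥ monomials 0 b t → w ⊥ monomials 0 c x →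
      sum u ⊗ (sum v ⊗ sum w) ≡ 0ℙ
    product≡0 (suc a) b c lt u⊥ v⊥ w⊥ = cong (_⊗ _) (ones (suc a) s (s≤s z≤n) u⊥)
    product≡0 zero (suc b) c lt u⊥ v⊥ w⊥ = trans
      (cong (λ z → sum u ⊗ (z ⊗ sum w)) (ones (suc b) t (s≤s z≤n) v⊥)) (ℙ.*-zeroʳ (sum u))
    product≡0 zero zero c lt u⊥ v⊥ w⊥ = trans
      (cong (λ z → sum u ⊗ (sum v ⊗ z)) (ones c x lt w⊥))
      (solve 2 (λ u v → u :* (v :* con 0ℙ) := con 0ℙ) refl (sum u) (sum v))
  trilinear-vanishes (suc m) a b c {u} {v} {w} s t x lt u⊥ v⊥ w⊥ = begin
    trilinear (suc m) u v w s t x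
      ≡⟨ sum³-cong (λ i j l → solve 7 (λ u v w a b c d →
           u :* (v :* (w :* ((con 1ℙ :+ a :+ b :+ c) :* d))) :=
           (u :* (v :* (w :* d)) :+ u :* a :* (v :* (w :* d))) :+
           (u :* (v :* b :* (w :* d)) :+ u :* (v :* (w :* c :* d)))) refl
           (u i) (v j) (w l) (head (s i)) (head (t j)) (head (x l)) _) ⟩
    sum³ _
      ≡⟨ sum³-+ (λ i j l → term u v w i j l ⊕ term (u ·ₛ) v w i j l)
                (λ i j l → term u (v ·ₜ) w i j l ⊕ term u v (w ·ₓ) i j l) ⟩
    sum³ _ ⊕ sum³ _
      ≡⟨ cong₂ _⊕_ (sum³-+ (term u v w) (term (u ·ₛ) v w))
                   (sum³-+ (term u (v ·ₜ) w) (term u v (w ·ₓ))) ⟩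
    (sum³ (term u v w) ⊕ sum³ (term (u ·ₛ) v w)) ⊕
    (sum³ (term u (v ·ₜ) w) ⊕ sum³ (term u v (w ·ₓ)))
      ≡⟨ cong₂ _⊕_
           (cong₂ _⊕_
             (trilinear-vanishes m a b c s′ t′ x′ (ℕ.<-trans (ℕ.n<1+n m) lt) u⊥′ v⊥′ w⊥′)
             (trilinear-vanishes m (pred a) b c s′ t′ x′
               (subst (m ℕ.<_) (sym (ℕ.+-assoc (pred a) b c))
                 (pred-bound a (subst (suc m ℕ.<_) (ℕ.+-assoc a b c) lt)))
               (⊥-monomials-head a s u⊥) v⊥′ w⊥′))
           (cong₂ _⊕_
             (trilinear-vanishes m a (pred b) c s′ t′ x′
               (subst (m ℕ.<_) (shift-b (pred b))
                 (pred-bound b (subst (suc m ℕ.<_) (sym (shift-b b)) lt)))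
               u⊥′ (⊥-monomials-head b t v⊥) w⊥′)
             (trilinear-vanishes m a b (pred c) s′ t′ x′
               (subst (m ℕ.<_) (ℕ.+-comm (pred c) (a + b))
                 (pred-bound c (subst (suc m ℕ.<_) (ℕ.+-comm (a + b) c) lt)))
               u⊥′ v⊥′ (⊥-monomials-head c x w⊥))) ⟩
    0ℙ ∎
    where
    open ≡-Reasoning
    s′ = tail ∘ s
    t′ = tail ∘ t
    x′ = tail ∘ x
    u⊥′ = ⊥-monomials-tail a s u⊥
    v⊥′ = ⊥-monomials-tail b t v⊥
    w⊥′ = ⊥-monomials-tail c x w⊥
    term : (u v w : Fin k → Parity) → Fin k → Fin k → Fin k → Parity
    term u v w i j l = u i ⊗ (v j ⊗ (w l ⊗ indicator m (s′ i) (t′ j) (x′ l)))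
    _·ₛ _·ₜ _·ₓ : (Fin k → Parity) → Fin k → Parity
    (u ·ₛ) i = u i ⊗ head (s i)
    (u ·ₜ) i = u i ⊗ head (t i)
    (u ·ₓ) i = u i ⊗ head (x i)
    shift-b : ∀ b → b + (a + c) ≡ a + b + c
    shift-b b = trans (sym (ℕ.+-assoc b a c)) (cong (_+ c) (ℕ.+-comm b a))

  -- Were k larger, some p would admit solutions u, v, w supported respectively
  -- on i ≥ p, on j ≤ p and anywhere, all nonzero at p; but s i + t j = x l with
  -- i ≥ p ≥ j forces i = j = l = p, and the trilinear form would equal 1.
  tricoloured-bound : ∀ m a (s t x : Fin k → Vec Parity m) → m ℕ.< a + a + a →
    (∀ i → s i ⊞ t i ≡ x i) →
    (∀ i j l → s i ⊞ t j ≡ x l → i Fin.≤ l × l Fin.≤ j) →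
    k ≤ #monomials m a * 3
  tricoloured-bound m a s t x m< diag ordered = ℕ.≮⇒≥ λ k> →
    let r = #monomials m a
        badˢ , badˢ≤ , solˢ =
          leading-solutions Fin._<_ (λ {i} → <-cotrans {i = i}) <-last (monomials m a s)
        badᵗ , badᵗ≤ , solᵗ =
          leading-solutions (λ i j → j Fin.< i) (λ {i} {j} → >-cotrans {i = i} {j}) >-last
            (monomials m a t)
        badˣ , badˣ≤ , solˣ =
          leading-solutions Fin._<_ (λ {i} → <-cotrans {i = i}) <-last (monomials m a x)
        bads≤ : length (badˢ ++ badᵗ ++ badˣ) ≤ r * 3
        bads≤ = subst₂ _≤_
          (sym (trans (List.length-++ badˢ) (cong (length badˢ +_) (List.length-++ badᵗ))))
          (trans (cong (λ z → r + (r + z)) (sym (ℕ.+-identityʳ r))) (ℕ.*-comm 3 r))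
          (ℕ.+-mono-≤ (subst (length badˢ ≤_) (length-monomials m a s) badˢ≤)
            (ℕ.+-mono-≤ (subst (length badᵗ ≤_) (length-monomials m a t) badᵗ≤)
                        (subst (length badˣ ≤_) (length-monomials m a x) badˣ≤)))
        p , p∉ = ∃-∉ (badˢ ++ badᵗ ++ badˣ) (ℕ.≤-<-trans bads≤ k>)
        u , (up , u<p) , u⊥ = solˢ p (p∉ ∘ Any.++⁺ˡ)
        v , (vp , v>p) , v⊥ = solᵗ p (p∉ ∘ Any.++⁺ʳ badˢ ∘ Any.++⁺ˡ)
        w , (wp , _)   , w⊥ = solˣ p (p∉ ∘ Any.++⁺ʳ badˢ ∘ Any.++⁺ʳ badᵗ)
    in contradiction
         (trans (sym (nonzero p u v w up vp wp u<p v>p))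
                (trilinear-vanishes m a a a s t x m< u⊥ v⊥ w⊥)) λ ()
    where
    module _ p (u v w : Fin k → Parity) (up : u p ≡ 1ℙ) (vp : v p ≡ 1ℙ) (wp : w p ≡ 1ℙ)
      (u<p : ∀ i → i Fin.< p → u i ≡ 0ℙ) (v>p : ∀ j → p Fin.< j → v j ≡ 0ℙ) where

      term : Fin k → Fin k → Fin k → Parity
      term i j l = u i ⊗ (v j ⊗ (w l ⊗ indicator m (s i) (t j) (x l)))

      nonzero⇒≡p : ∀ i j l → term i j l ≡ 1ℙ → i ≡ p × j ≡ p × l ≡ p
      nonzero⇒≡p i j l eq
        with u i in ui | v j in vj | w l | indicator m (s i) (t j) (x l) in ind
      ... | 1ℙ | 1ℙ | 1ℙ | 1ℙ =
        Fin.≤-antisym (ℕ.≤-trans i≤l (ℕ.≤-trans l≤j j≤p)) p≤i ,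
        Fin.≤-antisym j≤p (ℕ.≤-trans p≤i (ℕ.≤-trans i≤l l≤j)) ,
        Fin.≤-antisym (ℕ.≤-trans l≤j j≤p) (ℕ.≤-trans p≤i i≤l)
        where
        i≤l = proj₁ (ordered i j l (indicator≡1⇒ (s i) (t j) (x l) ind))
        l≤j = proj₂ (ordered i j l (indicator≡1⇒ (s i) (t j) (x l) ind))
        p≤i = ℕ.≮⇒≥ λ i<p → contradiction (trans (sym ui) (u<p i i<p)) λ ()
        j≤p = ℕ.≮⇒≥ λ p<j → contradiction (trans (sym vj) (v>p j p<j)) λ ()

      zero-off-p : ∀ i j l → ¬ (i ≡ p × j ≡ p × l ≡ p) → term i j l ≡ 0ℙ
      zero-off-p i j l ≢p with term i j l in eq
      ... | 0ℙ = refl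
      ... | 1ℙ = contradiction (nonzero⇒≡p i j l eq) ≢p

      nonzero : trilinear m u v w s t x ≡ 1ℙ
      nonzero = begin
        sum (λ i → sum (λ j → sum (term i j)))
          ≡⟨ sum-single p _ (λ i i≢p → sum-zero _ λ j → sum-zero _ λ l →
               zero-off-p i j l (i≢p ∘ proj₁)) ⟩
        sum (λ j → sum (term p j))
          ≡⟨ sum-single p _ (λ j j≢p → sum-zero _ λ l →
               zero-off-p p j l (j≢p ∘ proj₁ ∘ proj₂)) ⟩
        sum (term p p)
          ≡⟨ sum-single p _ (λ l l≢p → zero-off-p p p l (l≢p ∘ proj₂ ∘ proj₂)) ⟩
        u p ⊗ (v p ⊗ (w p ⊗ indicator m (s p) (t p) (x p)))
          ≡⟨ cong₂ _⊗_ up (cong₂ _⊗_ vp (cong₂ _⊗_ wp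
               (trans (cong (indicator m (s p) (t p)) (sym (diag p)))
                      (indicator-sum (s p) (t p))))) ⟩
        1ℙ ∎
        where open ≡-Reasoning

-- A Chernoff bound: give a monomial of degree i the weight 2^(a-1-i). It is at least 1 for i below
-- a, and the weights of all monomials sum to 2^(a-1) (3/2)^m. The induction checks this without
-- fractions.
#monomials-bound : ∀ m a → #monomials m a * 2 ^ suc m ≤ 3 ^ m * 2 ^ a
#monomials-bound zero    zero    = z≤n
#monomials-bound zero    (suc a) =
  subst (2 ≤_) (sym (ℕ.+-identityʳ (2 ^ suc a)))
    (ℕ.*-monoʳ-≤ 2 (ℕ.m^n>0 2 a))
#monomials-bound (suc m) zero    = subst (_≤ 3 ^ suc m * 1)
  (cong (λ z → z * 2 ^ suc (suc m)) (sym (#monomials-zero (suc m)))) z≤n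
  where
  #monomials-zero : ∀ m → #monomials m 0 ≡ 0
  #monomials-zero zero    = refl
  #monomials-zero (suc m) = cong₂ _+_ (#monomials-zero m) (#monomials-zero m)
#monomials-bound (suc m) (suc a) = begin
  (r + r′) * (2 * 2 ^ suc m)             ≡⟨ solve-step₁ r r′ (2 ^ suc m) ⟩
  2 * (r * 2 ^ suc m) + 2 * (r′ * 2 ^ suc m)
    ≤⟨ ℕ.+-mono-≤ (ℕ.*-monoʳ-≤ 2 (#monomials-bound m (suc a)))
                  (ℕ.*-monoʳ-≤ 2 (#monomials-bound m a)) ⟩
  2 * (3 ^ m * (2 * 2 ^ a)) + 2 * (3 ^ m * 2 ^ a) ≡⟨ solve-step₂ (3 ^ m) (2 ^ a) ⟩
  3 * 3 ^ m * (2 * 2 ^ a)                ∎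
  where
  open ℕ.≤-Reasoning
  r  = #monomials m (suc a)
  r′ = #monomials m a
  solve-step₁ : ∀ r r′ p → (r + r′) * (2 * p) ≡ 2 * (r * p) + 2 * (r′ * p)
  solve-step₁ = solve-∀
  solve-step₂ : ∀ p q → 2 * (p * (2 * q)) + 2 * (p * q) ≡ 3 * p * (2 * q)
  solve-step₂ = solve-∀

-- Compression of finite sets by linear maps

𝟘 : Vec Parity m
𝟘 = Vec.replicate _ 0ℙ

infixl 7 _∙_
_∙_ : Vec Parity m → Vec Parity m → Parity
[]      ∙ []      = 0ℙ
(a ∷ c) ∙ (b ∷ x) = a ⊗ b ⊕ c ∙ x

∙-⊞ : (c x y : Vec Parity m) → c ∙ (x ⊞ y) ≡ c ∙ x ⊕ c ∙ y
∙-⊞ []      []      []      = refl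
∙-⊞ (a ∷ c) (x ∷ xs) (y ∷ ys) = trans (cong (a ⊗ (x ⊕ y) ⊕_) (∙-⊞ c xs ys))
  (solve 5 (λ a x y p q → a :* (x :+ y) :+ (p :+ q) := a :* x :+ p :+ (a :* y :+ q))
    refl a x y (c ∙ xs) (c ∙ ys))

level : Parity → Vec Parity m → List (Vec Parity m) → List (Vec Parity m)
level a c = List.filter (λ x → c ∙ x ℙ.≟ a)

level-split : (c : Vec Parity m) (xs : List (Vec Parity m)) →
  length (level 0ℙ c xs) + length (level 1ℙ c xs) ≡ length xs
level-split c []       = refl
level-split c (x ∷ xs) with c ∙ x
... | 0ℙ = cong suc (level-split c xs)
... | 1ℙ = trans (ℕ.+-suc _ _) (cong suc (level-split c xs))

slice : Parity → List (Vec Parity (suc m)) → List (Vec Parity m)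
slice a []             = []
slice 0ℙ ((0ℙ ∷ x) ∷ xs) = x ∷ slice 0ℙ xs
slice 0ℙ ((1ℙ ∷ x) ∷ xs) = slice 0ℙ xs
slice 1ℙ ((0ℙ ∷ x) ∷ xs) = slice 1ℙ xs
slice 1ℙ ((1ℙ ∷ x) ∷ xs) = x ∷ slice 1ℙ xs

length-slices : (xs : List (Vec Parity (suc m))) →
  length (slice 0ℙ xs) + length (slice 1ℙ xs) ≡ length xs
length-slices []              = refl
length-slices ((0ℙ ∷ x) ∷ xs) = cong suc (length-slices xs)
length-slices ((1ℙ ∷ x) ∷ xs) = trans (ℕ.+-suc _ _) (cong suc (length-slices xs))

slice-nonzero : (xs : List (Vec Parity (suc m))) → All (_≢ 𝟘) xs → All (_≢ 𝟘) (slice 0ℙ xs)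
slice-nonzero []              []        = []
slice-nonzero ((0ℙ ∷ x) ∷ xs) (x≢ ∷ xs≢) = x≢ ∘ cong (0ℙ ∷_) ∷ slice-nonzero xs xs≢
slice-nonzero ((1ℙ ∷ x) ∷ xs) (x≢ ∷ xs≢) = slice-nonzero xs xs≢

-- A vector with first coordinate 0 is killed when c kills its tail; with first coordinate 1 the
-- functional is `a ⊕ c ∙ x`, which vanishes in characteristic 2 when `c ∙ x` equals a.
length-kernel : ∀ a (c : Vec Parity m) (xs : List (Vec Parity (suc m))) →
  length (level 0ℙ (a ∷ c) xs) ≡
  length (level 0ℙ c (slice 0ℙ xs)) + length (level a c (slice 1ℙ xs))
length-kernel a c [] = refl
length-kernel 0ℙ c ((0ℙ ∷ x) ∷ xs) with c ∙ x
... | 0ℙ = cong suc (length-kernel 0ℙ c xs)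
... | 1ℙ = length-kernel 0ℙ c xs
length-kernel 0ℙ c ((1ℙ ∷ x) ∷ xs) with c ∙ x
... | 0ℙ = trans (cong suc (length-kernel 0ℙ c xs)) (sym (ℕ.+-suc _ _))
... | 1ℙ = length-kernel 0ℙ c xs
length-kernel 1ℙ c ((0ℙ ∷ x) ∷ xs) with c ∙ x
... | 0ℙ = cong suc (length-kernel 1ℙ c xs)
... | 1ℙ = length-kernel 1ℙ c xs
length-kernel 1ℙ c ((1ℙ ∷ x) ∷ xs) with c ∙ x
... | 0ℙ = length-kernel 1ℙ c xs
... | 1ℙ = trans (cong suc (length-kernel 1ℙ c xs)) (sym (ℕ.+-suc _ _))

minority-level : (c : Vec Parity m) (xs : List (Vec Parity m)) →
  ∃[ a ] length (level a c xs) * 2 ≤ length xs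
minority-level c xs with ℕ.≤-total (length (level 0ℙ c xs)) (length (level 1ℙ c xs))
... | inj₁ 0≤1 = 0ℙ , subst₂ _≤_ (double (length (level 0ℙ c xs))) (level-split c xs)
                        (ℕ.+-monoʳ-≤ (length (level 0ℙ c xs)) 0≤1)
  where
  double : ∀ n → n + n ≡ n * 2
  double = solve-∀
... | inj₂ 1≤0 = 1ℙ , subst₂ _≤_ (double (length (level 1ℙ c xs))) (level-split c xs)
                        (ℕ.+-monoˡ-≤ (length (level 1ℙ c xs)) 1≤0)
  where
  double : ∀ n → n + n ≡ n * 2
  double = solve-∀

-- The coefficients are chosen one at a time, each so as to kill at most half
-- of the vectors whose last coordinate to be examined is the current one.
halving-functional : (xs : List (Vec Parity m)) → All (_≢ 𝟘) xs →
  ∃[ c ] length (level 0ℙ c xs) * 2 ≤ length xs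
halving-functional {zero} []        _        = [] , z≤n
halving-functional {zero} ([] ∷ xs) (x≢ ∷ _) = contradiction refl x≢
halving-functional {suc m} xs xs≢ =
  let c , half₀ = halving-functional (slice 0ℙ xs) (slice-nonzero xs xs≢)
      a , half₁ = minority-level c (slice 1ℙ xs)
  in a ∷ c , (begin
    length (level 0ℙ (a ∷ c) xs) * 2     ≡⟨ cong (_* 2) (length-kernel a c xs) ⟩
    (length (level 0ℙ c (slice 0ℙ xs)) + length (level a c (slice 1ℙ xs))) * 2
      ≡⟨ ℕ.*-distribʳ-+ 2 (length (level 0ℙ c (slice 0ℙ xs))) _ ⟩
    length (level 0ℙ c (slice 0ℙ xs)) * 2 + length (level a c (slice 1ℙ xs)) * 2
      ≤⟨ ℕ.+-mono-≤ half₀ half₁ ⟩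
    length (slice 0ℙ xs) + length (slice 1ℙ xs) ≡⟨ length-slices xs ⟩
    length xs ∎)
  where open ℕ.≤-Reasoning

Additive : (Vec Parity D → Vec Parity m) → Set
Additive φ = ∀ x y → φ (x ⊞ y) ≡ φ x ⊞ φ y

-- Each coordinate of `φ` is a functional that halves the nonzero vectors surviving in the kernel of
-- the previous ones. Fewer than 2^m vectors are exhausted after m halvings.
compression : ∀ m (xs : List (Vec Parity D)) → length xs ℕ.< 2 ^ m →
  ∃[ φ ] (Additive {D} {m} φ × (∀ {x} → x ∈ xs → φ x ≡ 𝟘 → x ≡ 𝟘))
compression {D} m xs xs< =
  let φ , additive , kernel = nonzero m (List.filter ≢𝟘? xs)
        (ℕ.≤-<-trans (List.length-filter ≢𝟘? xs) xs<) (All.all-filter ≢𝟘? xs)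
  in φ , additive , λ {x} x∈ φx≡𝟘 → decidable-stable (x ≟ 𝟘) λ x≢𝟘 →
       kernel (∈-filter⁺ ≢𝟘? x∈ x≢𝟘) φx≡𝟘
  where
  _≟_ : (x y : Vec Parity D) → Dec (x ≡ y)
  _≟_ = Vec.≡-dec ℙ._≟_
  ≢𝟘? : (x : Vec Parity D) → Dec (x ≢ 𝟘)
  ≢𝟘? x = ¬? (x ≟ 𝟘)
  nonzero : ∀ m (xs : List (Vec Parity D)) → length xs ℕ.< 2 ^ m → All (_≢ 𝟘) xs →
    ∃[ φ ] (Additive {D} {m} φ × (∀ {x} → x ∈ xs → φ x ≢ 𝟘))
  nonzero zero    []       _         _   = (λ _ → []) , (λ _ _ → refl) , λ ()
  nonzero zero    (_ ∷ _)  (s≤s ()) _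
  nonzero (suc m) xs       xs<       xs≢ =
    let c , half = halving-functional xs xs≢
        φ , additive , kernel = nonzero m (level 0ℙ c xs)
          (ℕ.*-cancelʳ-< 2 _ _ (ℕ.≤-<-trans half (subst (length xs ℕ.<_) (ℕ.*-comm 2 (2 ^ m)) xs<)))
          (All.filter⁺ (λ x → c ∙ x ℙ.≟ 0ℙ) xs≢)
    in (λ x → c ∙ x ∷ φ x) , (λ x y → cong₂ _∷_ (∙-⊞ c x y) (additive x y)) ,
       λ x∈ eq → kernel (∈-filter⁺ (λ x → c ∙ x ℙ.≟ 0ℙ) x∈ (Vec.∷-injectiveˡ eq))
                        (Vec.∷-injectiveʳ eq)

-- Popular sums

sum-mono : {f g : Fin k → ℕ} → (∀ i → f i ≤ g i) → Σℕ.sum f ≤ Σℕ.sum g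
sum-mono {zero}  f≤g = z≤n
sum-mono {suc k} f≤g = ℕ.+-mono-≤ (f≤g zero) (sum-mono (f≤g ∘ suc))

sum-const : ∀ k c → Σℕ.sum {k} (λ _ → c) ≡ k * c
sum-const zero    c = refl
sum-const (suc k) c = cong (c +_) (sum-const k c)

term≤sum : (f : Fin k → ℕ) (p : Fin k) → f p ≤ Σℕ.sum f
term≤sum f zero    = ℕ.m≤m+n _ _
term≤sum f (suc p) = ℕ.≤-trans (term≤sum (f ∘ suc) p) (ℕ.m≤n+m _ (f zero))

sum-++ : ∀ m n (f : Fin (m + n) → ℕ) →
  Σℕ.sum f ≡ Σℕ.sum (λ i → f (i ↑ˡ n)) + Σℕ.sum (λ j → f (m ↑ʳ j))
sum-++ zero    n f = refl
sum-++ (suc m) n f =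
  trans (cong (f zero +_) (sum-++ m n (f ∘ suc))) (sym (ℕ.+-assoc (f zero) _ _))

sum-combine : ∀ m n (f : Fin (m * n) → ℕ) →
  Σℕ.sum f ≡ Σℕ.sum (λ i → Σℕ.sum (λ j → f (combine {m} i j)))
sum-combine zero    n f = refl
sum-combine (suc m) n f =
  trans (sum-++ n (m * n) f)
    (cong (Σℕ.sum (λ i → f (i ↑ˡ m * n)) +_) (sum-combine m n (λ i → f (n ↑ʳ i))))

∃-minimum : .{{_ : NonZero k}} (f : Fin k → ℕ) → ∃[ p ] (∀ i → f p ≤ f i)
∃-minimum {suc zero}    f = zero , λ { zero → ℕ.≤-refl }
∃-minimum {suc (suc k)} f with ∃-minimum (f ∘ suc)
... | p , min with ℕ.≤-total (f zero) (f (suc p))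
...   | inj₁ le = zero  , λ { zero → ℕ.≤-refl ; (suc i) → ℕ.≤-trans le (min i) }
...   | inj₂ ge = suc p , λ { zero → ge ; (suc i) → min i }

∃-below-average : .{{_ : NonZero k}} (f : Fin k → ℕ) → ∃[ p ] k * f p ≤ Σℕ.sum f
∃-below-average {k} f with ∃-minimum f
... | p , min = p , subst (_≤ Σℕ.sum f) (sum-const k (f p)) (sum-mono min)

𝟙 : {A : Set} → Dec A → ℕ
𝟙 (yes _) = 1
𝟙 (no  _) = 0

# : {P : Fin k → Set} → (∀ i → Dec (P i)) → ℕ
# P? = Σℕ.sum (λ i → 𝟙 (P? i))

StrictlyMonotone : (Fin k → Fin n) → Set
StrictlyMonotone e = ∀ x y → x Fin.< y → e x Fin.< e y

-- The enumeration is increasing so that passing to a subset of the indices of a half-graph respects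
-- their order.
enumeration : {P : Fin k → Set} (P? : ∀ i → Dec (P i)) →
  ∃[ e ] (StrictlyMonotone {# P?} e × (∀ x → P (e x)))
enumeration {zero}  P? = (λ ()) , (λ ()) , λ ()
enumeration {suc k} P? with P? zero | enumeration (P? ∘ suc)
... | yes p₀ | e , mono , Pe =
  (λ { zero → zero ; (suc x) → suc (e x) }) ,
  (λ { zero (suc y) _ → s≤s z≤n ; (suc x) (suc y) (s≤s x<y) → s≤s (mono x y x<y) }) ,
  λ { zero → p₀ ; (suc x) → Pe x }
... | no _   | e , mono , Pe = suc ∘ e , (λ x y x<y → s≤s (mono x y x<y)) , Pe

<-mono⇒injective : (e : Fin k → Fin n) → StrictlyMonotone e → Injective _≡_ _≡_ e
<-mono⇒injective e mono {x} {y} eq with Fin.<-cmp x y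
... | tri< x<y _ _ = contradiction (cong Fin.toℕ eq) (ℕ.<⇒≢ (mono x y x<y))
... | tri≈ _ x≡y _ = x≡y
... | tri> _ _ y<x = contradiction (cong Fin.toℕ (sym eq)) (ℕ.<⇒≢ (mono y x y<x))

fibre : (Fin k → Fin N) → Fin N → ℕ
fibre f z = # (λ i → f i Fin.≟ z)

#-rare : ∀ (f : Fin k → Fin N) d T →
  # (λ i → ¬? (T ℕ.≤? d * fibre f (f i))) * d ≤ N * T
#-rare {k} {N} f d T = begin
  Σℕ.sum (λ i → rare (f i)) * d
    -- Indices are grouped by their value z. For each rare z the product of d and the fibre size
    -- stays below T, and there are N values in all.
    ≤⟨ ℕ.*-monoˡ-≤ d (sum-mono λ i → ℕ.≤-trans (at i) (term≤sum _ (f i))) ⟩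
  Σℕ.sum (λ i → Σℕ.sum (λ z → 𝟙 (f i Fin.≟ z) * rare z)) * d
    ≡⟨ cong (_* d) (Σℕ.∑-comm (λ i z → 𝟙 (f i Fin.≟ z) * rare z)) ⟩
  Σℕ.sum (λ z → Σℕ.sum (λ i → 𝟙 (f i Fin.≟ z) * rare z)) * d
    ≡⟨ cong (_* d) (Σℕ.sum-cong-≗ λ z → sym (Σℕ.*-distribʳ-sum (rare z) (λ i → 𝟙 (f i Fin.≟ z)))) ⟩
  Σℕ.sum (λ z → fibre f z * rare z) * d
    ≡⟨ Σℕ.*-distribʳ-sum d (λ z → fibre f z * rare z) ⟩
  Σℕ.sum (λ z → fibre f z * rare z * d)
    ≤⟨ sum-mono light ⟩
  Σℕ.sum {N} (λ _ → T)
    ≡⟨ sum-const N T ⟩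
  N * T ∎
  where
  open ℕ.≤-Reasoning
  rare : Fin N → ℕ
  rare z = 𝟙 (¬? (T ℕ.≤? d * fibre f z))
  at : ∀ i → rare (f i) ≤ 𝟙 (f i Fin.≟ f i) * rare (f i)
  at i with f i Fin.≟ f i
  ... | yes _ = ℕ.≤-reflexive (sym (ℕ.+-identityʳ _))
  ... | no ≢  = contradiction refl ≢
  light : ∀ z → fibre f z * rare z * d ≤ T
  light z with T ℕ.≤? d * fibre f z
  ... | yes _ = subst (λ x → x * d ≤ T) (sym (ℕ.*-zeroʳ (fibre f z))) z≤n
  ... | no  h = subst (_≤ T)
    (trans (ℕ.*-comm d _) (cong (_* d) (sym (ℕ.*-identityʳ (fibre f z)))))
    (ℕ.<⇒≤ (ℕ.≰⇒> h))

module _ (a : Fin n → Fin n → Fin N) where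

  flatten : Fin (n * n) → Fin N
  flatten i = uncurry a (remQuot n i)

  -- The mean fibre has size n² / N. Asking for a quarter of the mean leaves at most a quarter of
  -- all pairs with an unpopular value.
  Popular : Fin N → Set
  Popular z = n * n ≤ 4 * N * fibre flatten z

  popular? : ∀ z → Dec (Popular z)
  popular? z = n * n ℕ.≤? 4 * N * fibre flatten z

  -- Averaging over the columns: since at most n² / 4 pairs are unpopular, some column contains at
  -- most n / 4 of them.
  mostly-popular-column : .{{_ : NonZero n}} .{{_ : NonZero N}} →
    ∃[ u ] # (λ l → ¬? (popular? (a l u))) * 4 ≤ n
  mostly-popular-column =
    let u , avg = ∃-below-average (λ u → # (λ l → ¬? (popular? (a l u)))) in
    u , ℕ.*-cancelˡ-≤ n (begin
      n * (# (λ l → ¬? (popular? (a l u))) * 4)  ≡⟨ ℕ.*-assoc n _ 4 ⟨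
      n * # (λ l → ¬? (popular? (a l u))) * 4    ≤⟨ ℕ.*-monoˡ-≤ 4 avg ⟩
      Σℕ.sum (λ u → # (λ l → ¬? (popular? (a l u)))) * 4
        ≡⟨ cong (_* 4) (Σℕ.∑-comm (λ u l → 𝟙 (¬? (popular? (a l u))))) ⟩
      Σℕ.sum (λ l → Σℕ.sum (λ u → 𝟙 (¬? (popular? (a l u))))) * 4
        ≡⟨ cong (_* 4) (Σℕ.sum-cong-≗ {n} λ l → Σℕ.sum-cong-≗ {n} λ u →
             cong (λ p → 𝟙 (¬? (popular? (uncurry a p)))) (sym (Fin.remQuot-combine l u))) ⟩
      Σℕ.sum {n} (λ l → Σℕ.sum {n} (λ u → 𝟙 (¬? (popular? (flatten (combine l u)))))) * 4
        ≡⟨ cong (_* 4) (sum-combine n n (λ i → 𝟙 (¬? (popular? (flatten i))))) ⟨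
      # (λ i → ¬? (popular? (flatten i))) * 4
        ≤⟨ ℕ.*-cancelˡ-≤ N (subst (_≤ N * (n * n))
             (regroup (# (λ i → ¬? (popular? (flatten i)))) N)
             (#-rare flatten (4 * N) (n * n))) ⟩
      n * n ∎)
    where
    open ℕ.≤-Reasoning
    regroup : ∀ x N → x * (4 * N) ≡ N * (x * 4)
    regroup = solve-∀

  representations : ∀ {z τ} → τ ≤ fibre flatten z →
    ∃[ e ] (Injective _≡_ _≡_ e × (∀ (x : Fin τ) → uncurry a (e x) ≡ z))
  representations {z} τ≤ =
    let e , mono , eq = enumeration (λ i → flatten i Fin.≟ z) in
    (λ x → remQuot n (e (inject≤ x τ≤))) ,
    (λ {x} {y} eq → Fin.inject≤-injective τ≤ τ≤ x y
       (<-mono⇒injective e mono (Injection.injective (↔⇒↣ Fin.*↔×) eq))) ,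
    λ x → eq (inject≤ x τ≤)

#-good : {P Q : Fin n → Set} (P? : ∀ i → Dec (P i)) (Q? : ∀ i → Dec (Q i)) →
  # (¬? ∘ P?) * 4 ≤ n → # (¬? ∘ Q?) * 4 ≤ n → n ≤ # (λ i → P? i ×-dec Q? i) * 2
#-good {n} P? Q? #¬P≤ #¬Q≤ = ℕ.*-cancelʳ-≤ n (g * 2) 2
  (ℕ.+-cancelˡ-≤ (n + n) (n * 2) (g * 2 * 2) (begin
  -- Each condition fails for at most n / 4 indices, so both hold for at least half. The summand n +
  -- n on both sides replaces a subtraction.
  n + n + n * 2                    ≡⟨ quadruple n ⟩
  n * 4                            ≤⟨ ℕ.*-monoˡ-≤ 4 total ⟩
  (# (¬? ∘ P?) + # (¬? ∘ Q?) + g) * 4 ≡⟨ distrib (# (¬? ∘ P?)) (# (¬? ∘ Q?)) g ⟩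
  # (¬? ∘ P?) * 4 + # (¬? ∘ Q?) * 4 + g * 2 * 2 ≤⟨ ℕ.+-monoˡ-≤ (g * 2 * 2) (ℕ.+-mono-≤ #¬P≤ #¬Q≤) ⟩
  n + n + g * 2 * 2 ∎))
  where
  open ℕ.≤-Reasoning
  g = # (λ i → P? i ×-dec Q? i)
  quadruple : ∀ n → n + n + n * 2 ≡ n * 4
  quadruple = solve-∀
  distrib : ∀ x y z → (x + y + z) * 4 ≡ x * 4 + y * 4 + z * 2 * 2
  distrib = solve-∀
  cover : ∀ i → 1 ≤ 𝟙 (¬? (P? i)) + 𝟙 (¬? (Q? i)) + 𝟙 (P? i ×-dec Q? i)
  cover i with P? i | Q? i
  ... | yes _ | yes _ = s≤s z≤n
  ... | yes _ | no  _ = s≤s z≤n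
  ... | no  _ | _     = s≤s z≤n
  total : n ≤ # (¬? ∘ P?) + # (¬? ∘ Q?) + g
  total = begin
    n                       ≡⟨ trans (sum-const n 1) (ℕ.*-identityʳ n) ⟨
    Σℕ.sum {n} (λ _ → 1)    ≤⟨ sum-mono cover ⟩
    Σℕ.sum (λ i → 𝟙 (¬? (P? i)) + 𝟙 (¬? (Q? i)) + 𝟙 (P? i ×-dec Q? i))
      ≡⟨ Σℕ.∑-distrib-+ (λ i → 𝟙 (¬? (P? i)) + 𝟙 (¬? (Q? i))) _ ⟩
    Σℕ.sum (λ i → 𝟙 (¬? (P? i)) + 𝟙 (¬? (Q? i))) + g
      ≡⟨ cong (_+ g) (Σℕ.∑-distrib-+ (λ i → 𝟙 (¬? (P? i))) _) ⟩
    # (¬? ∘ P?) + # (¬? ∘ Q?) + g ∎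

-- Used to fix one integer τ that is a lower bound for every popular fibre and still satisfies n² ≤
-- 4Nτ.
∃-ceiling-quotient : ∀ d .{{_ : NonZero d}} T → ∃[ τ ] (T ≤ d * τ × (∀ c → T ≤ d * c → τ ≤ c))
∃-ceiling-quotient d zero    = 0 , z≤n , λ _ _ → z≤n
∃-ceiling-quotient d (suc T) with ∃-ceiling-quotient d T
... | τ , T≤ , min with suc T ℕ.≤? d * τ
...   | yes T<  = τ , T< , λ c T<c → min c (ℕ.≤-trans (ℕ.n≤1+n T) T<c)
...   | no  T≮  = suc τ ,
  subst (suc T ≤_) (sym (ℕ.*-suc d τ)) (ℕ.+-mono-≤ (ℕ.>-nonZero⁻¹ d) T≤) ,
  λ c T<c → ℕ.≤∧≢⇒< (min c (ℕ.≤-trans (ℕ.n≤1+n T) T<c)) λ { refl → T≮ T<c }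

-- The excess of a half-graph

⊞-cancelˡ : (x : Vec Parity m) {y z : Vec Parity m} → x ⊞ y ≡ x ⊞ z → y ≡ z
⊞-cancelˡ []      {[]}    {[]}    _  = refl
⊞-cancelˡ (a ∷ x) {b ∷ y} {c ∷ z} eq =
  cong₂ _∷_ (ℙ.+-cancelˡ-≡ a b c (Vec.∷-injectiveˡ eq)) (⊞-cancelˡ x (Vec.∷-injectiveʳ eq))

⊞-cancelʳ : (x : Vec Parity m) {y z : Vec Parity m} → y ⊞ x ≡ z ⊞ x → y ≡ z
⊞-cancelʳ []      {[]}    {[]}    _  = refl
⊞-cancelʳ (a ∷ x) {b ∷ y} {c ∷ z} eq =
  cong₂ _∷_ (ℙ.+-cancelʳ-≡ a b c (Vec.∷-injectiveˡ eq)) (⊞-cancelʳ x (Vec.∷-injectiveʳ eq))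

⊞-self : (x : Vec Parity m) → x ⊞ x ≡ 𝟘
⊞-self []      = refl
⊞-self (a ∷ x) = cong₂ _∷_ (ℙ.p+p≡0ℙ a) (⊞-self x)

⊞≡𝟘⇒≡ : (x y : Vec Parity m) → x ⊞ y ≡ 𝟘 → x ≡ y
⊞≡𝟘⇒≡ x y eq = sym (⊞-cancelˡ x (trans eq (sym (⊞-self x))))

-- The letters d and e occur twice and cancel. In `excess-count` they are `t₃ u′` and `s₁ v′`, so u′
-- and v′ are free and each contributes a factor n.
telescope : (a b c d e f g h : Vec Parity m) →
  (a ⊞ b) ⊞ ((c ⊞ d) ⊞ ((e ⊞ d) ⊞ ((e ⊞ f) ⊞ (g ⊞ h)))) ≡ (a ⊞ h) ⊞ ((c ⊞ b) ⊞ (g ⊞ f))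
telescope [] [] [] [] [] [] [] [] = refl
telescope (a ∷ as) (b ∷ bs) (c ∷ cs) (d ∷ ds) (e ∷ es) (f ∷ fs) (g ∷ gs) (h ∷ hs) = cong₂ _∷_
  (solve 8 (λ a b c d e f g h →
    a :+ b :+ (c :+ d :+ (e :+ d :+ (e :+ f :+ (g :+ h)))) := a :+ h :+ (c :+ b :+ (g :+ f)))
    refl a b c d e f g h)
  (telescope as bs cs ds es fs gs hs)

⊞-regroup : (a b c d e : Vec Parity m) → a ⊞ ((b ⊞ c) ⊞ (d ⊞ e)) ≡ (a ⊞ (b ⊞ e)) ⊞ (d ⊞ c)
⊞-regroup [] [] [] [] [] = refl
⊞-regroup (a ∷ as) (b ∷ bs) (c ∷ cs) (d ∷ ds) (e ∷ es) = cong₂ _∷_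
  (solve 5 (λ a b c d e → a :+ (b :+ c :+ (d :+ e)) := a :+ (b :+ e) :+ (d :+ c)) refl a b c d e)
  (⊞-regroup as bs cs ds es)

lookup-injective : {A : Set} {xs : List A} → Unique xs →
  Injective _≡_ _≡_ (List.lookup xs)
lookup-injective (x∉ ∷ _)  {zero}  {zero}  _  = refl
lookup-injective (x∉ ∷ _)  {zero}  {suc j} eq =
  contradiction eq (All.lookup x∉ (∈-lookup j))
lookup-injective (x∉ ∷ _)  {suc i} {zero}  eq =
  contradiction (sym eq) (All.lookup x∉ (∈-lookup i))
lookup-injective (_ ∷ xs!) {suc i} {suc j} eq = cong suc (lookup-injective xs! eq)

*⁵↔×⁵ : ∀ a b c d e →
  Fin (a * (b * (c * (d * e)))) ↔ (Fin a × Fin b × Fin c × Fin d × Fin e)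
*⁵↔×⁵ a b c d e =
  (↔-id (Fin a) ×-↔
    ((↔-id (Fin b) ×-↔ ((↔-id (Fin c) ×-↔ Fin.*↔×) ↔-∘ Fin.*↔×)) ↔-∘ Fin.*↔×)) ↔-∘ Fin.*↔×

-- The subscripts 1, 2, 3 name the three consecutive blocks of indices. An element of `Fin N` stands
-- for an element of A, and the tables record which one each sum across two blocks is.
record SumTables (D n N : ℕ) : Set where
  field
    s₁ s₂ t₂ t₃    : Fin n → Vec Parity D
    val            : Fin N → Vec Parity D
    a₁₂ a₁₃ a₂₃    : Fin n → Fin n → Fin N
    val₁₂          : ∀ i j → val (a₁₂ i j) ≡ s₁ i ⊞ t₂ j
    val₁₃          : ∀ i j → val (a₁₃ i j) ≡ s₁ i ⊞ t₃ j
    val₂₃          : ∀ i j → val (a₂₃ i j) ≡ s₂ i ⊞ t₃ j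
    s₁-injective   : Injective _≡_ _≡_ s₁
    s₂-injective   : Injective _≡_ _≡_ s₂
    t₂-injective   : Injective _≡_ _≡_ t₂
    t₃-injective   : Injective _≡_ _≡_ t₃

module _ {D n N} (tables : SumTables D n N) where

  open SumTables tables

  -- It vanishes precisely when the sum at (i , j) coincides with the diagonal sum at l. A linear
  -- map that kills no nonzero excess therefore creates no new coincidence of this kind.
  excess : Fin n × Fin n × Fin n → Vec Parity D
  excess (i , j , l) = (s₂ i ⊞ t₂ j) ⊞ (s₂ l ⊞ t₂ l)

  private
    injectiveˡ : ∀ {s t : Fin n → Vec Parity D} {a : Fin n → Fin n → Fin N} →
      (∀ i j → val (a i j) ≡ s i ⊞ t j) → Injective _≡_ _≡_ s →
      ∀ {i i′ j} → a i j ≡ a i′ j → i ≡ i′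
    injectiveˡ val-a s-inj {i} {i′} {j} eq = s-inj (⊞-cancelʳ _
      (trans (sym (val-a i j)) (trans (cong val eq) (val-a i′ j))))

    injectiveʳ : ∀ {s t : Fin n → Vec Parity D} {a : Fin n → Fin n → Fin N} →
      (∀ i j → val (a i j) ≡ s i ⊞ t j) → Injective _≡_ _≡_ t →
      ∀ {i j j′} → a i j ≡ a i j′ → j ≡ j′
    injectiveʳ val-a t-inj {i} {j} {j′} eq = t-inj (⊞-cancelˡ _
      (trans (sym (val-a i j)) (trans (cong val eq) (val-a i j′))))

  -- The excess at (i , j , l), shifted by s₁ v + t₃ u, is the sum of the five
  -- elements s₂ i + t₃ q, s₂ p + t₃ u′, s₁ v′ + t₃ u′, s₁ v′ + t₂ p′ and
  -- s₁ q′ + t₂ j whenever s₂ p + t₃ q = s₂ l + t₃ u and s₁ q′ + t₂ p′ = s₁ v + t₂ l.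
  excess-count : ∀ {M τ} u v (X : Fin M → Fin n × Fin n × Fin n) →
    Injective _≡_ _≡_ (excess ∘ X) →
    (∀ y → let _ , _ , l = X y in
      ∃[ e ] (Injective _≡_ _≡_ e × (∀ (x : Fin τ) → uncurry a₂₃ (e x) ≡ a₂₃ l u))) →
    (∀ y → let _ , _ , l = X y in
      ∃[ e ] (Injective _≡_ _≡_ e × (∀ (x : Fin τ) → uncurry (flip a₁₂) (e x) ≡ a₁₂ v l))) →
    M * (τ * (τ * (n * n))) ≤ N * (N * (N * (N * N)))
  excess-count {M} {τ} u v X X-injective reps₂₃ reps₁₂ = Fin.injective⇒≤
    (Injection.injective (↔⇒↣ (↔-sym (*⁵↔×⁵ N N N N N)) ↣-∘ (mk↣ five-injective ↣-∘
                          ↔⇒↣ (*⁵↔×⁵ M τ τ n n))))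
    where
    five : Fin M × Fin τ × Fin τ × Fin n × Fin n → Fin N × Fin N × Fin N × Fin N × Fin N
    five (y , x , x′ , u′ , v′) =
      let i , j , l = X y
          p , q     = proj₁ (reps₂₃ y) x
          p′ , q′   = proj₁ (reps₁₂ y) x′
      in a₂₃ i q , a₂₃ p u′ , a₁₃ v′ u′ , a₁₂ v′ p′ , a₁₂ q′ j

    total : Fin N × Fin N × Fin N × Fin N × Fin N → Vec Parity D
    total (a , b , c , d , e) = val a ⊞ (val b ⊞ (val c ⊞ (val d ⊞ val e)))

    total-five : ∀ w → total (five w) ≡ excess (X (proj₁ w)) ⊞ (s₁ v ⊞ t₃ u)
    total-five (y , x , x′ , u′ , v′) =
      let i , j , l = X y
          p , q     = proj₁ (reps₂₃ y) x
          p′ , q′   = proj₁ (reps₁₂ y) x′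
      in begin
      val (a₂₃ i q) ⊞ (val (a₂₃ p u′) ⊞ (val (a₁₃ v′ u′) ⊞ (val (a₁₂ v′ p′) ⊞ val (a₁₂ q′ j))))
        ≡⟨ cong₂ _⊞_ (val₂₃ i q) (cong₂ _⊞_ (val₂₃ p u′) (cong₂ _⊞_ (val₁₃ v′ u′)
             (cong₂ _⊞_ (val₁₂ v′ p′) (val₁₂ q′ j)))) ⟩
      (s₂ i ⊞ t₃ q) ⊞ ((s₂ p ⊞ t₃ u′) ⊞ ((s₁ v′ ⊞ t₃ u′) ⊞ ((s₁ v′ ⊞ t₂ p′) ⊞ (s₁ q′ ⊞ t₂ j))))
        ≡⟨ telescope (s₂ i) (t₃ q) (s₂ p) (t₃ u′) (s₁ v′) (t₂ p′) (s₁ q′) (t₂ j) ⟩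
      (s₂ i ⊞ t₂ j) ⊞ ((s₂ p ⊞ t₃ q) ⊞ (s₁ q′ ⊞ t₂ p′))
        ≡⟨ cong ((s₂ i ⊞ t₂ j) ⊞_) (cong₂ _⊞_
             (trans (sym (val₂₃ p q)) (trans (cong val (proj₂ (proj₂ (reps₂₃ y)) x)) (val₂₃ l u)))
             (trans (sym (val₁₂ q′ p′)) (trans (cong val (proj₂ (proj₂ (reps₁₂ y)) x′)) (val₁₂ v l)))) ⟩
      (s₂ i ⊞ t₂ j) ⊞ ((s₂ l ⊞ t₃ u) ⊞ (s₁ v ⊞ t₂ l))
        ≡⟨ ⊞-regroup (s₂ i ⊞ t₂ j) (s₂ l) (t₃ u) (s₁ v) (t₂ l) ⟩
      excess (X y) ⊞ (s₁ v ⊞ t₃ u) ∎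
      where open ≡-Reasoning

    pair≡ : ∀ {a : Fin n → Fin n → Fin N} {z} →
      (∀ {p p̃ q} → a p q ≡ a p̃ q → p ≡ p̃) → ∀ {w w̃} →
      uncurry a w ≡ z → uncurry a w̃ ≡ z → proj₂ w ≡ proj₂ w̃ → w ≡ w̃
    pair≡ inj {w = _ , q} eq eq̃ refl = cong (_, q) (inj (trans eq (sym eq̃)))

    five-injective : Injective _≡_ _≡_ five
    five-injective {w@(y , x , x′ , u′ , v′)} {w̃@(ỹ , x̃ , x̃′ , ũ′ , ṽ′)} eq
      -- The sum of the five elements is a fixed shift of the excess, so the five elements determine
      -- y and with it i, j and l.
      with refl ← X-injective (⊞-cancelʳ (s₁ v ⊞ t₃ u)
             (trans (sym (total-five w)) (trans (cong total eq) (total-five w̃))))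
      with eq₁ , eq′ ← ,-injective eq
      with eq₂ , eq′ ← ,-injective eq′
      with eq₃ , eq′ ← ,-injective eq′
      with eq₄ , eq₅ ← ,-injective eq′
      -- With i and j known, the first element yields q and the fifth yields q′. One half of a
      -- representation of a known element fixes the other half, hence also the labels x and x′.
      with refl ← proj₁ (proj₂ (reps₂₃ y)) (pair≡ {a₂₃} (injectiveˡ val₂₃ s₂-injective)
                    (proj₂ (proj₂ (reps₂₃ y)) x) (proj₂ (proj₂ (reps₂₃ y)) x̃)
                    (injectiveʳ val₂₃ t₃-injective eq₁))
         | refl ← proj₁ (proj₂ (reps₁₂ y)) (pair≡ {flip a₁₂} (injectiveʳ val₁₂ t₂-injective)
                    (proj₂ (proj₂ (reps₁₂ y)) x′) (proj₂ (proj₂ (reps₁₂ y)) x̃′)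
                    (injectiveˡ val₁₂ s₁-injective eq₅))
      -- Now p and p′ are known too, so the second element yields u′ and the fourth yields v′.
      = cong₂ (λ u v → y , x , x′ , u , v)
          (injectiveʳ val₂₃ t₃-injective eq₂) (injectiveˡ val₁₂ s₁-injective eq₄)

-- Comparison of the two bounds

∃-power-of-8 : ∀ M .{{_ : NonZero M}} → ∃[ h ] (M ℕ.< 8 ^ h × 8 ^ h ≤ M * 8)
∃-power-of-8 (suc zero)    = 1 , from-yes (2 ℕ.≤? 8) , ℕ.≤-refl
∃-power-of-8 (suc M@(suc _)) with ∃-power-of-8 M
... | h , M< , ≤8M with suc M ℕ.<? 8 ^ h
...   | yes 1+M< = h , 1+M< , ℕ.≤-trans ≤8M (ℕ.m≤n+m (M * 8) 8)
...   | no  1+M≮ with ℕ.≤-antisym (ℕ.≮⇒≥ 1+M≮) M<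
...     | eq = suc h ,
  subst (λ x → suc M ℕ.< 8 * x) (sym eq)
    (subst (suc M ℕ.<_) (ℕ.*-comm (suc M) 8) (ℕ.m<m*n (suc M) 8 (from-yes (2 ℕ.≤? 8)))) ,
  ℕ.≤-reflexive (trans (cong (8 *_) eq) (ℕ.*-comm 8 (suc M)))

^-distribʳ-* : ∀ m n o → (m * n) ^ o ≡ m ^ o * n ^ o
^-distribʳ-* m n zero    = refl
^-distribʳ-* m n (suc o) =
  trans (cong (m * n *_) (^-distribʳ-* m n o)) (interchange m n (m ^ o) (n ^ o))
  where
  interchange : ∀ a b c d → a * b * (c * d) ≡ a * c * (b * d)
  interchange = solve-∀

^-comm : ∀ m n o → (m ^ n) ^ o ≡ (m ^ o) ^ n
^-comm m n o = trans (ℕ.^-*-assoc m n o)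
  (trans (cong (m ^_) (ℕ.*-comm n o)) (sym (ℕ.^-*-assoc m o n)))

-- 54¹³ ≤ 8²⁵ is what turns the density 54 ^ h / 8 ^ h of the low-degree
-- monomials into a saving of the power 1/13 of 8 ^ h.
power-saving : ∀ n h → n * 8 ^ h ≤ 54 ^ h * 6 → n ^ 13 ≤ (8 ^ h) ^ 12 * 6 ^ 13
power-saving n h le = ℕ.*-cancelʳ-≤ (n ^ 13) _ ((8 ^ h) ^ 13)
  {{ℕ.m^n≢0 (8 ^ h) 13 {{ℕ.m^n≢0 8 h}}}} (begin
  n ^ 13 * (8 ^ h) ^ 13                 ≡⟨ ^-distribʳ-* n (8 ^ h) 13 ⟨
  (n * 8 ^ h) ^ 13                      ≤⟨ ℕ.^-monoˡ-≤ 13 le ⟩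
  (54 ^ h * 6) ^ 13                     ≡⟨ ^-distribʳ-* (54 ^ h) 6 13 ⟩
  (54 ^ h) ^ 13 * 6 ^ 13                ≡⟨ cong (_* 6 ^ 13) (^-comm 54 h 13) ⟩
  (54 ^ 13) ^ h * 6 ^ 13
    ≤⟨ ℕ.*-monoˡ-≤ (6 ^ 13) (ℕ.^-monoˡ-≤ h (from-yes (54 ^ 13 ℕ.≤? 8 ^ 25))) ⟩
  (8 ^ 25) ^ h * 6 ^ 13                 ≡⟨ cong (_* 6 ^ 13) (^-comm 8 25 h) ⟩
  (8 ^ h) ^ 25 * 6 ^ 13                 ≡⟨ cong (_* 6 ^ 13) (ℕ.^-distribˡ-+-* (8 ^ h) 12 13) ⟩
  (8 ^ h) ^ 12 * (8 ^ h) ^ 13 * 6 ^ 13  ≡⟨ swap₂₃ ((8 ^ h) ^ 12) ((8 ^ h) ^ 13) (6 ^ 13) ⟩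
  (8 ^ h) ^ 12 * 6 ^ 13 * (8 ^ h) ^ 13  ∎)
  where
  open ℕ.≤-Reasoning
  swap₂₃ : ∀ a b c → a * b * c ≡ a * c * b
  swap₂₃ = solve-∀

-- The inequality n² ≤ 4Nτ is used once for each of the two factors τ in the count, at a total cost
-- of 16 N².
excess-bound : ∀ {n N M τ} → M * (τ * (τ * (n * n))) ≤ N * (N * (N * (N * N))) →
  n * n ≤ 4 * N * τ → M * n ^ 6 ≤ N ^ 7 * 16
excess-bound {n} {N} {M} {τ} count n²≤ = begin
  M * n ^ 6                            ≡⟨ cong (M *_) (expand n) ⟩
  M * (n * n * (n * n * (n * n)))      ≤⟨ ℕ.*-monoʳ-≤ M (ℕ.*-mono-≤ n²≤ (ℕ.*-monoˡ-≤ (n * n) n²≤)) ⟩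
  M * (4 * N * τ * (4 * N * τ * (n * n))) ≡⟨ regroup M N τ n ⟩
  M * (τ * (τ * (n * n))) * (N * N * 16)  ≤⟨ ℕ.*-monoˡ-≤ (N * N * 16) count ⟩
  N * (N * (N * (N * N))) * (N * N * 16)  ≡⟨ collect N ⟩
  N ^ 7 * 16                           ∎
  where
  open ℕ.≤-Reasoning
  expand : ∀ n → n * (n * (n * (n * (n * (n * 1))))) ≡ n * n * (n * n * (n * n))
  expand = solve-∀
  regroup : ∀ M N τ n →
    M * (4 * N * τ * (4 * N * τ * (n * n))) ≡ M * (τ * (τ * (n * n))) * (N * N * 16)
  regroup = solve-∀
  collect : ∀ N → N * (N * (N * (N * N))) * (N * N * 16) ≡
    N * (N * (N * (N * (N * (N * (N * 1)))))) * 16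
  collect = solve-∀

-- The exponents come from 85 = 13 + 6 · 12: the saving bounds n^13 by a constant times M^12, and
-- the remaining n^72 completes M^12 to (M n^6)^12, which is at most a constant times N^84.
combine-bounds : ∀ {n N M h} → n * 8 ^ h ≤ 54 ^ h * 6 → 8 ^ h ≤ M * 8 →
  M * n ^ 6 ≤ N ^ 7 * 16 → n ^ 85 ≤ N ^ 84 * (16 ^ 12 * (8 ^ 12 * 6 ^ 13))
combine-bounds {n} {N} {M} {h} saving 8^h≤ excess≤ = begin
  n ^ 85                                ≡⟨ ℕ.^-distribˡ-+-* n 13 72 ⟩
  n ^ 13 * n ^ 72                       ≤⟨ ℕ.*-monoˡ-≤ (n ^ 72) (power-saving n h saving) ⟩
  (8 ^ h) ^ 12 * 6 ^ 13 * n ^ 72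
    ≤⟨ ℕ.*-monoˡ-≤ (n ^ 72) (ℕ.*-monoˡ-≤ (6 ^ 13) (ℕ.^-monoˡ-≤ 12 8^h≤)) ⟩
  (M * 8) ^ 12 * 6 ^ 13 * n ^ 72
    ≡⟨ cong₂ (λ x y → x * 6 ^ 13 * y) (^-distribʳ-* M 8 12) (sym (ℕ.^-*-assoc n 6 12)) ⟩
  M ^ 12 * 8 ^ 12 * 6 ^ 13 * (n ^ 6) ^ 12
    ≡⟨ regroup (M ^ 12) (8 ^ 12) (6 ^ 13) ((n ^ 6) ^ 12) ⟩
  M ^ 12 * (n ^ 6) ^ 12 * (8 ^ 12 * 6 ^ 13)
    ≡⟨ cong (_* (8 ^ 12 * 6 ^ 13)) (sym (^-distribʳ-* M (n ^ 6) 12)) ⟩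
  (M * n ^ 6) ^ 12 * (8 ^ 12 * 6 ^ 13)
    ≤⟨ ℕ.*-monoˡ-≤ (8 ^ 12 * 6 ^ 13) (ℕ.^-monoˡ-≤ 12 excess≤) ⟩
  (N ^ 7 * 16) ^ 12 * (8 ^ 12 * 6 ^ 13)
    ≡⟨ cong (_* (8 ^ 12 * 6 ^ 13)) (^-distribʳ-* (N ^ 7) 16 12) ⟩
  (N ^ 7) ^ 12 * 16 ^ 12 * (8 ^ 12 * 6 ^ 13)
    ≡⟨ cong (λ x → x * 16 ^ 12 * (8 ^ 12 * 6 ^ 13)) (ℕ.^-*-assoc N 7 12) ⟩
  N ^ 84 * 16 ^ 12 * (8 ^ 12 * 6 ^ 13)  ≡⟨ ℕ.*-assoc (N ^ 84) (16 ^ 12) (8 ^ 12 * 6 ^ 13) ⟩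
  N ^ 84 * (16 ^ 12 * (8 ^ 12 * 6 ^ 13)) ∎
  where
  open ℕ.≤-Reasoning
  regroup : ∀ a b c d → a * b * c * d ≡ a * d * (b * c)
  regroup = solve-∀

-- In dimension 3h with degrees below h + 1, `#monomials-bound` says that the number of monomials
-- times 8^h is at most (3³ · 2)^h = 54^h. The factor 6 is 3 from the tri-coloured bound times 2
-- from n ≤ 2k.
saving-of-bound : ∀ {n k h} → n ≤ k * 2 → k ≤ #monomials (3 * h) (suc h) * 3 →
  n * 8 ^ h ≤ 54 ^ h * 6
saving-of-bound {n} {k} {h} n≤ k≤ = begin
  n * 8 ^ h                        ≤⟨ ℕ.*-monoˡ-≤ (8 ^ h) (ℕ.≤-trans n≤ (ℕ.*-monoˡ-≤ 2 k≤)) ⟩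
  r * 3 * 2 * 8 ^ h                ≡⟨ cong (r * 3 * 2 *_) (ℕ.^-*-assoc 2 3 h) ⟩
  r * 3 * 2 * 2 ^ (3 * h)          ≡⟨ regroup₁ r (2 ^ (3 * h)) ⟩
  r * 2 ^ suc (3 * h) * 3          ≤⟨ ℕ.*-monoˡ-≤ 3 (#monomials-bound (3 * h) (suc h)) ⟩
  3 ^ (3 * h) * 2 ^ suc h * 3      ≡⟨ cong (λ z → z * 2 ^ suc h * 3) (ℕ.^-*-assoc 3 3 h) ⟨
  27 ^ h * (2 * 2 ^ h) * 3         ≡⟨ regroup₂ (27 ^ h) (2 ^ h) ⟩
  27 ^ h * 2 ^ h * 6               ≡⟨ cong (_* 6) (^-distribʳ-* 27 2 h) ⟨
  54 ^ h * 6                       ∎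
  where
  open ℕ.≤-Reasoning
  r = #monomials (3 * h) (suc h)
  regroup₁ : ∀ r p → r * 3 * 2 * p ≡ r * (2 * p) * 3
  regroup₁ = solve-∀
  regroup₂ : ∀ p q → p * (2 * q) * 3 ≡ p * q * 6
  regroup₂ = solve-∀

-- If `φ (s i) ⊞ φ (t j)` equals `φ (s l) ⊞ φ (t l)`, then the excess lies in the kernel of `φ`,
-- hence is zero, and the equation already holds before compression. So the images inherit the
-- ordering and the tri-coloured bound applies in dimension 3h.
compressed-bound : ∀ {D k h} (s t : Fin k → Vec Parity D) (xs : List (Vec Parity D)) →
  length xs ℕ.< 8 ^ h → (∀ i j l → (s i ⊞ t j) ⊞ (s l ⊞ t l) ∈ xs) →
  (∀ i j l → s i ⊞ t j ≡ s l ⊞ t l → i Fin.≤ l × l Fin.≤ j) →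
  k ≤ #monomials (3 * h) (suc h) * 3
compressed-bound {h = h} s t xs xs< excess∈ ordered =
  let φ , additive , kernel = compression (3 * h) xs
        (subst (length xs ℕ.<_) (ℕ.^-*-assoc 2 3 h) xs<)
      φ-⊞ : ∀ w x y z → φ w ⊞ φ x ≡ φ y ⊞ φ z → φ ((w ⊞ x) ⊞ (y ⊞ z)) ≡ 𝟘
      φ-⊞ w x y z eq = trans (additive (w ⊞ x) (y ⊞ z))
        (trans (cong₂ _⊞_ (trans (additive w x) eq) (additive y z)) (⊞-self (φ y ⊞ φ z)))
  in tricoloured-bound (3 * h) (suc h) (φ ∘ s) (φ ∘ t) (λ l → φ (s l) ⊞ φ (t l))
       (ℕ.≤-trans (ℕ.m≤n+m (suc (3 * h)) 2) (ℕ.≤-reflexive (thrice h)))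
       (λ _ → refl)
       λ i j l eq → ordered i j l
         (⊞≡𝟘⇒≡ _ _ (kernel (excess∈ i j l) (φ-⊞ (s i) (t j) (s l) (t l) eq)))
  where
  thrice : ∀ h → 2 + suc (3 * h) ≡ suc h + suc h + suc h
  thrice = solve-∀

module _ {D n N} .{{_ : NonZero n}} .{{_ : NonZero N}} (tables : SumTables D n N) where

  open SumTables tables

  -- Only middle indices l with both `s₂ l + t₃ u` and `s₁ v + t₂ l` popular are kept. They are at
  -- least half of all, and their excesses are few enough to compress the space.
  half-graph-bound :
    (∀ i j l → s₂ i ⊞ t₂ j ≡ s₂ l ⊞ t₂ l → i Fin.≤ l × l Fin.≤ j) →
    n ^ 85 ≤ N ^ 84 * (16 ^ 12 * (8 ^ 12 * 6 ^ 13))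
  half-graph-bound ordered = combine-bounds {n} {N} {length xs} {h}
    (saving-of-bound {n} {K} {h} n≤2k
      (compressed-bound {h = h} (s₂ ∘ e) (t₂ ∘ e) xs xs< excess∈ ordered-e))
    8^h≤ (excess-bound {n} {N} {length xs} {τ} count n²≤)
    where
    column₂₃ = mostly-popular-column a₂₃
    u = proj₁ column₂₃
    -- Flipping makes the first block index the columns, so v is fixed there while l runs through
    -- the middle block.
    column₁₂ = mostly-popular-column (flip a₁₂)
    v = proj₁ column₁₂
    good? = λ l → popular? a₂₃ (a₂₃ l u) ×-dec popular? (flip a₁₂) (a₁₂ v l)
    K = # good?

    n≤2k : n ≤ K * 2
    n≤2k = #-good (λ l → popular? a₂₃ (a₂₃ l u)) (λ l → popular? (flip a₁₂) (a₁₂ v l))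
             (proj₂ column₂₃) (proj₂ column₁₂)

    e : Fin K → Fin n
    e = proj₁ (enumeration good?)
    e-mono : StrictlyMonotone e
    e-mono = proj₁ (proj₂ (enumeration good?))
    e-good : ∀ x → Popular a₂₃ (a₂₃ (e x) u) × Popular (flip a₁₂) (a₁₂ v (e x))
    e-good = proj₂ (proj₂ (enumeration good?))

    e-reflects-≤ : ∀ x y → e x Fin.≤ e y → x Fin.≤ y
    e-reflects-≤ x y ex≤ey = ℕ.≮⇒≥ λ y<x → ℕ.<⇒≱ (e-mono y x y<x) ex≤ey

    ordered-e : ∀ i j l → s₂ (e i) ⊞ t₂ (e j) ≡ s₂ (e l) ⊞ t₂ (e l) → i Fin.≤ l × l Fin.≤ j
    ordered-e i j l eq = let i≤l , l≤j = ordered (e i) (e j) (e l) eq in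
      e-reflects-≤ i l i≤l , e-reflects-≤ l j l≤j

    τ = proj₁ (∃-ceiling-quotient (4 * N) {{ℕ.m*n≢0 4 N}} (n * n))
    n²≤ = proj₁ (proj₂ (∃-ceiling-quotient (4 * N) {{ℕ.m*n≢0 4 N}} (n * n)))
    τ-minimal = proj₂ (proj₂ (∃-ceiling-quotient (4 * N) {{ℕ.m*n≢0 4 N}} (n * n)))

    _≟_ : (x y : Vec Parity D) → Dec (x ≡ y)
    _≟_ = Vec.≡-dec ℙ._≟_

    triple : Fin K × Fin K × Fin K → Fin n × Fin n × Fin n
    triple (i , j , l) = e i , e j , e l
    excess′ : Fin K × Fin K × Fin K → Vec Parity D
    excess′ = excess tables ∘ triple
    index↔ : Fin (K * (K * K)) ↔ (Fin K × Fin K × Fin K)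
    index↔ = (↔-id (Fin K) ×-↔ Fin.*↔×) ↔-∘ Fin.*↔×
    open Inverse index↔ using (to; from; strictlyInverseˡ)

    all xs : List (Vec Parity D)
    all = List.tabulate (excess′ ∘ to)
    -- Repetitions are removed so that the length counts distinct excesses, which is the injectivity
    -- that `excess-count` asks for.
    xs = List.deduplicate _≟_ all

    xs! : Unique xs
    xs! = deduplicate-! _≟_ all

    excess∈ : ∀ i j l → excess′ (i , j , l) ∈ xs
    excess∈ i j l = ∈-deduplicate⁺ _≟_ (subst (_∈ all)
      (cong excess′ (strictlyInverseˡ (i , j , l))) (∈-tabulate⁺ (from (i , j , l))))

    source : ∀ y → ∃[ w ] List.lookup xs y ≡ excess′ w
    source y = let i , eq = ∈-tabulate⁻ (∈-deduplicate⁻ _≟_ all (∈-lookup {xs = xs} y)) in to i , eq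

    count : length xs * (τ * (τ * (n * n))) ≤ N * (N * (N * (N * N)))
    count = excess-count tables u v (triple ∘ proj₁ ∘ source)
      (λ {y} {y′} eq → lookup-injective xs!
        (trans (proj₂ (source y)) (trans eq (sym (proj₂ (source y′))))))
      (λ y → let _ , _ , l = proj₁ (source y) in
        representations a₂₃ (τ-minimal _ (proj₁ (e-good l))))
      (λ y → let _ , _ , l = proj₁ (source y) in
        representations (flip a₁₂) (τ-minimal _ (proj₂ (e-good l))))

    some-index : Fin K
    some-index = Fin.fromℕ< (ℕ.≰⇒> λ K≤0 →
      ℕ.<⇒≱ (ℕ.>-nonZero⁻¹ n) (ℕ.≤-trans n≤2k (ℕ.*-monoˡ-≤ 2 {K} {0} K≤0)))

    instance
      xs-nonEmpty : NonZero (length xs)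
      xs-nonEmpty = Fin.nonZeroIndex (Any.index (excess∈ some-index some-index some-index))

    -- A power of 8 = 2³ makes the target dimension 3h divisible by 3, so that a third of it is the
    -- integer h; rounding up costs at most a factor 8.
    h = proj₁ (∃-power-of-8 (length xs))
    xs< = proj₁ (proj₂ (∃-power-of-8 (length xs)))
    8^h≤ = proj₂ (proj₂ (∃-power-of-8 (length xs)))

-- From 𝔽₂^∞ to finite-dimensional spaces

-- In characteristic 2, add b + d to both sides.
⊞-exchange : (a b c d : Vec Parity m) → a ⊞ b ≡ c ⊞ d → a ⊞ d ≡ c ⊞ b
⊞-exchange []       []       []       []       _  = refl
⊞-exchange (a ∷ as) (b ∷ bs) (c ∷ cs) (d ∷ ds) eq = cong₂ _∷_
  (trans (solve 3 (λ a b d → a :+ d := a :+ b :+ (b :+ d)) refl a b d)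
    (trans (cong (_⊕ (b ⊕ d)) (Vec.∷-injectiveˡ eq))
      (solve 3 (λ c b d → c :+ d :+ (b :+ d) := c :+ b) refl c b d)))
  (⊞-exchange as bs cs ds (Vec.∷-injectiveʳ eq))

-- The hypotheses `upper` and `separated` retain what is used of A after restriction to D
-- coordinates: sums with i ≤ j are among the N values, and no sum with i > j coincides with one of
-- them.
module _ {D k n N} .{{_ : NonZero n}} .{{_ : NonZero N}} (3n≤k : n + (n + n) ≤ k)
  {s t : Fin k → Vec Parity D} {val : Fin N → Vec Parity D}
  (upper : ∀ {i j} → i Fin.≤ j → ∃[ a ] val a ≡ s i ⊞ t j)
  (separated : ∀ {i j i′ j′} → i Fin.≤ j → s i ⊞ t j ≡ s i′ ⊞ t j′ → i′ Fin.≤ j′)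
  where

  private
    s-injective : Injective _≡_ _≡_ s
    s-injective {i} {i′} eq = Fin.≤-antisym
      (separated {i′} {i′} ℕ.≤-refl (cong (_⊞ t i′) (sym eq)))
      (separated {i} {i} ℕ.≤-refl (cong (_⊞ t i) eq))

    t-injective : Injective _≡_ _≡_ t
    t-injective {j} {j′} eq = Fin.≤-antisym
      (separated {j} {j} ℕ.≤-refl (cong (s j ⊞_) eq))
      (separated {j′} {j′} ℕ.≤-refl (cong (s j′ ⊞_) (sym eq)))

    ordered : ∀ i j l → s i ⊞ t j ≡ s l ⊞ t l → i Fin.≤ l × l Fin.≤ j
    ordered i j l eq with i Fin.≤? l
    ... | yes i≤l = i≤l , separated i≤l (⊞-exchange (s i) (t j) (s l) (t l) eq)
    ... | no  i≰l = contradiction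
      -- Here l < i, and i ≤ j since the sum at (i , j) equals a diagonal one. Thus l ≤ j, and the
      -- exchanged equation s l + t j = s i + t l would force i ≤ l.
      (separated (ℕ.≤-trans (ℕ.<⇒≤ (ℕ.≰⇒> i≰l)) i≤j)
                 (sym (⊞-exchange (s i) (t j) (s l) (t l) eq))) i≰l
      where i≤j = separated {l} {l} ℕ.≤-refl (sym eq)

    block₁ block₂ block₃ : Fin n → Fin k
    block₁ i = inject≤ (i ↑ˡ (n + n)) 3n≤k
    block₂ i = inject≤ (n ↑ʳ (i ↑ˡ n)) 3n≤k
    block₃ i = inject≤ (n ↑ʳ (n ↑ʳ i)) 3n≤k

    toℕ-block₁ : ∀ i → Fin.toℕ (block₁ i) ≡ Fin.toℕ i
    toℕ-block₁ i = trans (Fin.toℕ-inject≤ _ 3n≤k) (Fin.toℕ-↑ˡ i (n + n))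

    toℕ-block₂ : ∀ i → Fin.toℕ (block₂ i) ≡ n + Fin.toℕ i
    toℕ-block₂ i = trans (Fin.toℕ-inject≤ _ 3n≤k)
      (trans (Fin.toℕ-↑ʳ n (i ↑ˡ n)) (cong (λ z → n + z) (Fin.toℕ-↑ˡ i n)))

    toℕ-block₃ : ∀ i → Fin.toℕ (block₃ i) ≡ n + (n + Fin.toℕ i)
    toℕ-block₃ i = trans (Fin.toℕ-inject≤ _ 3n≤k)
      (trans (Fin.toℕ-↑ʳ n (n ↑ʳ i)) (cong (λ z → n + z) (Fin.toℕ-↑ʳ n i)))

    block₁≤block₂ : ∀ i j → block₁ i Fin.≤ block₂ j
    block₁≤block₂ i j rewrite toℕ-block₁ i | toℕ-block₂ j =
      ℕ.≤-trans (ℕ.<⇒≤ (Fin.toℕ<n i)) (ℕ.m≤m+n n _)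

    block₂≤block₃ : ∀ i j → block₂ i Fin.≤ block₃ j
    block₂≤block₃ i j rewrite toℕ-block₂ i | toℕ-block₃ j =
      ℕ.+-monoʳ-≤ n (ℕ.≤-trans (ℕ.<⇒≤ (Fin.toℕ<n i)) (ℕ.m≤m+n n _))

    block₁≤block₃ : ∀ i j → block₁ i Fin.≤ block₃ j
    block₁≤block₃ i j = ℕ.≤-trans (block₁≤block₂ i j) (block₂≤block₃ j j)

    block₂-reflects-≤ : ∀ i j → block₂ i Fin.≤ block₂ j → i Fin.≤ j
    block₂-reflects-≤ i j le =
      ℕ.+-cancelˡ-≤ n _ _ (subst₂ _≤_ (toℕ-block₂ i) (toℕ-block₂ j) le)

    block₁-injective : Injective _≡_ _≡_ block₁
    block₁-injective eq = Fin.↑ˡ-injective (n + n) _ _ (Fin.inject≤-injective 3n≤k 3n≤k _ _ eq)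

    block₂-injective : Injective _≡_ _≡_ block₂
    block₂-injective eq = Fin.↑ˡ-injective n _ _
      (Fin.↑ʳ-injective n _ _ (Fin.inject≤-injective 3n≤k 3n≤k _ _ eq))

    block₃-injective : Injective _≡_ _≡_ block₃
    block₃-injective eq = Fin.↑ʳ-injective n _ _
      (Fin.↑ʳ-injective n _ _ (Fin.inject≤-injective 3n≤k 3n≤k _ _ eq))

    tables : SumTables D n N
    tables = record
      { s₁ = s ∘ block₁ ; s₂ = s ∘ block₂ ; t₂ = t ∘ block₂ ; t₃ = t ∘ block₃ ; val = val
      ; a₁₂ = λ i j → proj₁ (upper (block₁≤block₂ i j))
      ; a₁₃ = λ i j → proj₁ (upper (block₁≤block₃ i j))
      ; a₂₃ = λ i j → proj₁ (upper (block₂≤block₃ i j))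
      ; val₁₂ = λ i j → proj₂ (upper (block₁≤block₂ i j))
      ; val₁₃ = λ i j → proj₂ (upper (block₁≤block₃ i j))
      ; val₂₃ = λ i j → proj₂ (upper (block₂≤block₃ i j))
      ; s₁-injective = block₁-injective ∘ s-injective
      ; s₂-injective = block₂-injective ∘ s-injective
      ; t₂-injective = block₂-injective ∘ t-injective
      ; t₃-injective = block₃-injective ∘ t-injective
      }

  order-bound : n ^ 85 ≤ N ^ 84 * (16 ^ 12 * (8 ^ 12 * 6 ^ 13))
  order-bound = half-graph-bound tables λ i j l eq →
    let i≤l , l≤j = ordered (block₂ i) (block₂ j) (block₂ l) eq in
    block₂-reflects-≤ i l i≤l , block₂-reflects-≤ l j l≤j

-- Constants and rational exponents

k≤2+[k/3]*3 : ∀ k → k ≤ 2 + k ℕ./ 3 * 3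
k≤2+[k/3]*3 k = subst (_≤ 2 + k ℕ./ 3 * 3) (sym (ℕ.m≡m%n+[m/n]*n k 3))
  (ℕ.+-monoˡ-≤ (k ℕ./ 3 * 3) (ℕ.≤-pred (ℕ.m%n<n k 3)))

2+n*3≤n*5 : ∀ n .{{_ : NonZero n}} → 2 + n * 3 ≤ n * 5
2+n*3≤n*5 n = subst (2 + n * 3 ≤_) (split n)
  (ℕ.+-monoˡ-≤ (n * 3) (ℕ.*-monoˡ-≤ 2 (ℕ.>-nonZero⁻¹ n)))
  where
  split : ∀ n → n * 2 + n * 3 ≡ n * 5
  split = solve-∀

-- Apply the bound to the block length n = ⌊k / 3⌋. If n is positive then k ≤ 3n + 2 ≤ 5n, which
-- accounts for the factor 5^a; if n = 0 then k ≤ 2, and the hypothesis on 2^a takes over.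
order-bound-contradiction : ∀ {k N} a b K C .{{_ : NonZero N}} →
  2 ^ a ℕ.< C ^ a → K * 5 ^ a ℕ.< C ^ a → N ^ b * C ^ a ≤ k ^ a →
  ¬ (∀ n .{{_ : NonZero n}} → n + (n + n) ≤ k → n ^ a ≤ N ^ b * K)
order-bound-contradiction {k} {N} a b K C 2^a< K*5^a< large bound = ℕ.<⇒≱ small large
  where
  open ℕ.≤-Reasoning
  q = k ℕ./ 3
  instance
    N^b≢0 : NonZero (N ^ b)
    N^b≢0 = ℕ.m^n≢0 N b
  thrice : ∀ n → n * 3 ≡ n + (n + n)
  thrice = solve-∀
  small-quotient : q ≡ 0 → k ^ a ℕ.< N ^ b * C ^ a
  small-quotient q≡0 = begin-strict
    k ^ a          ≤⟨ ℕ.^-monoˡ-≤ a (subst (λ q → k ≤ 2 + q * 3) q≡0 (k≤2+[k/3]*3 k)) ⟩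
    2 ^ a          <⟨ 2^a< ⟩
    C ^ a          ≤⟨ ℕ.m≤n*m (C ^ a) (N ^ b) ⟩
    N ^ b * C ^ a  ∎
  large-quotient : .{{_ : NonZero q}} → k ^ a ℕ.< N ^ b * C ^ a
  large-quotient = begin-strict
    k ^ a                ≤⟨ ℕ.^-monoˡ-≤ a (ℕ.≤-trans (k≤2+[k/3]*3 k) (2+n*3≤n*5 q)) ⟩
    (q * 5) ^ a          ≡⟨ ^-distribʳ-* q 5 a ⟩
    q ^ a * 5 ^ a
      ≤⟨ ℕ.*-monoˡ-≤ (5 ^ a) (bound q (subst (_≤ k) (thrice q) (ℕ.m/n*n≤m k 3))) ⟩
    N ^ b * K * 5 ^ a    ≡⟨ ℕ.*-assoc (N ^ b) K (5 ^ a) ⟩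
    N ^ b * (K * 5 ^ a)  <⟨ ℕ.*-monoʳ-< (N ^ b) K*5^a< ⟩
    N ^ b * C ^ a        ∎
  small : k ^ a ℕ.< N ^ b * C ^ a
  small with q ℕ.≟ 0
  ... | yes q≡0 = small-quotient q≡0
  ... | no  q≢0 = large-quotient {{ℕ.≢-nonZero q≢0}}

-- A literal already in lowest terms, so that its numerator and denominator are visible to
-- computation; `fromℕ≡/1` relates it to the quotient form.
fromℕ : ℕ → ℚ
fromℕ a = mkℚ (ℤ.+ a) 0 (coprime-sym (1-coprimeTo a))

fromℕ≡/1 : ∀ a → fromℕ a ≡ ℤ.+ a ℚ./ 1
fromℕ≡/1 a = sym (ℚ.↥p/↧p≡p (fromℕ a))

fromℕ-* : ∀ a b → fromℕ a ℚ.* fromℕ b ≡ fromℕ (a * b)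
fromℕ-* a b = trans (cong (ℚ._/ 1) (sym (ℤ.pos-* a b))) (sym (fromℕ≡/1 (a * b)))

fromℕ-^ : ∀ a v → fromℕ a ^ℚ v ≡ fromℕ (a ^ v)
fromℕ-^ a zero    = refl
fromℕ-^ a (suc v) = trans (cong (fromℕ a ℚ.*_) (fromℕ-^ a v)) (fromℕ-* a (a ^ v))

fromℕ-reflects-≤ : ∀ {a b} → fromℕ a ℚ.≤ fromℕ b → a ≤ b
fromℕ-reflects-≤ {a} {b} (ℚ.*≤* le) =
  ℤ.drop‿+≤+ (subst₂ ℤ._≤_ (ℤ.*-identityʳ (ℤ.+ a)) (ℤ.*-identityʳ (ℤ.+ b)) le)

power-inequality : ∀ k C M v →
  (ℤ.+ k ℚ./ 1) ^ℚ v ℚ.≥ (ℤ.+ C ℚ./ 1) ^ℚ v ℚ.* (ℤ.+ M ℚ./ 1) → M * C ^ v ≤ k ^ v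
power-inequality k C M v le = fromℕ-reflects-≤ (subst₂ ℚ._≤_
  (begin
    (ℤ.+ C ℚ./ 1) ^ℚ v ℚ.* (ℤ.+ M ℚ./ 1)  ≡⟨ cong₂ (λ x y → x ^ℚ v ℚ.* y) (fromℕ≡/1 C) (fromℕ≡/1 M) ⟨
    fromℕ C ^ℚ v ℚ.* fromℕ M          ≡⟨ cong (ℚ._* fromℕ M) (fromℕ-^ C v) ⟩
    fromℕ (C ^ v) ℚ.* fromℕ M         ≡⟨ fromℕ-* (C ^ v) M ⟩
    fromℕ (C ^ v * M)                 ≡⟨ cong fromℕ (ℕ.*-comm (C ^ v) M) ⟩
    fromℕ (M * C ^ v)                 ∎)
  (trans (cong (_^ℚ v) (sym (fromℕ≡/1 k))) (fromℕ-^ k v))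
  le)
  where open ≡-Reasoning

-- Restriction of finitely supported sequences

private
  module F = AbelianGroup 𝔽₂^∞

support : F.Carrier → ℕ
support (_ , d , _) = d

restrict : ∀ D → F.Carrier → Vec Parity D
restrict D (f , _) = Vec.tabulate (f ∘ Fin.toℕ {D})

tabulate-⊞ : (f g : Fin m → Parity) →
  Vec.tabulate (λ i → f i ⊕ g i) ≡ Vec.tabulate f ⊞ Vec.tabulate g
tabulate-⊞ {zero}  f g = refl
tabulate-⊞ {suc m} f g = cong (f zero ⊕ g zero ∷_) (tabulate-⊞ (f ∘ suc) (g ∘ suc))

restrict-∙ : ∀ D x y → restrict D (x F.∙ y) ≡ restrict D x ⊞ restrict D y
restrict-∙ D x y = tabulate-⊞ (proj₁ x ∘ Fin.toℕ) (proj₁ y ∘ Fin.toℕ)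

restrict-cong : ∀ D {x y} → x F.≈ y → restrict D x ≡ restrict D y
restrict-cong D x≈y = Vec.tabulate-cong (x≈y ∘ Fin.toℕ)

-- From position D onwards both sequences vanish, so the first D coordinates decide equality.
restrict-injective : ∀ {D x y} → support x ≤ D → support y ≤ D →
  restrict D x ≡ restrict D y → x F.≈ y
restrict-injective {D} {f , d , f≡0} {g , d′ , g≡0} d≤D d′≤D eq i with i ℕ.<? D
... | yes i<D = begin
  f i                       ≡⟨ cong f (Fin.toℕ-fromℕ< i<D) ⟨
  f (Fin.toℕ j)             ≡⟨ Vec.lookup∘tabulate (f ∘ Fin.toℕ) j ⟨
  Vec.lookup (restrict D (f , d , f≡0)) j   ≡⟨ cong (λ x → Vec.lookup x j) eq ⟩
  Vec.lookup (restrict D (g , d′ , g≡0)) j  ≡⟨ Vec.lookup∘tabulate (g ∘ Fin.toℕ) j ⟩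
  g (Fin.toℕ j)             ≡⟨ cong g (Fin.toℕ-fromℕ< i<D) ⟩
  g i                       ∎
  where
  open ≡-Reasoning
  j = Fin.fromℕ< i<D
... | no  i≮D = trans (f≡0 i (ℕ.≤-trans d≤D (ℕ.≮⇒≥ i≮D)))
                      (sym (g≡0 i (ℕ.≤-trans d′≤D (ℕ.≮⇒≥ i≮D))))

order-property-bound : ∀ {N k n} .{{_ : NonZero N}} .{{_ : NonZero n}} (A : Pred F.Carrier 0ℓ) →
  A Respects F._≈_ → HasSize F.setoid A N → HasOrderProperty 𝔽₂^∞ k A → n + (n + n) ≤ k →
  n ^ 85 ≤ N ^ 84 * (16 ^ 12 * (8 ^ 12 * 6 ^ 13))
order-property-bound {N} {k} A resp size (s , t , s∙t∈A⇔≤) 3n≤k =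
  order-bound 3n≤k {restrict d ∘ s} {restrict d ∘ t} {restrict d ∘ proj₁ ∘ to} upper separated
  where
  open Bijection size using (to; surjective)
  -- The total of all support bounds serves as a common bound for the supports of all the sums
  -- `s i ∙ t j`.
  d = Σℕ.sum (support ∘ s) + Σℕ.sum (support ∘ t)

  upper : ∀ {i j} → i Fin.≤ j →
    ∃[ a ] restrict d (proj₁ (to a)) ≡ restrict d (s i) ⊞ restrict d (t j)
  upper {i} {j} i≤j =
    let a , to-a = surjective (s i F.∙ t j , Equivalence.from (s∙t∈A⇔≤ i j) i≤j) in
    a , trans (restrict-cong d {proj₁ (to a)} {s i F.∙ t j} (to-a refl))
              (restrict-∙ d (s i) (t j))

  support≤ : ∀ i j → support (s i F.∙ t j) ≤ d
  support≤ i j = ℕ.⊔-lub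
    (ℕ.≤-trans (term≤sum (support ∘ s) i) (ℕ.m≤m+n _ _))
    (ℕ.≤-trans (term≤sum (support ∘ t) j) (ℕ.m≤n+m _ (Σℕ.sum (support ∘ s))))

  separated : ∀ {i j i′ j′} → i Fin.≤ j →
    restrict d (s i) ⊞ restrict d (t j) ≡ restrict d (s i′) ⊞ restrict d (t j′) → i′ Fin.≤ j′
  separated {i} {j} {i′} {j′} i≤j eq = Equivalence.to (s∙t∈A⇔≤ i′ j′) (resp
    (restrict-injective {x = s i F.∙ t j} {s i′ F.∙ t j′} (support≤ i j) (support≤ i′ j′)
      (trans (restrict-∙ d (s i) (t j)) (trans eq (sym (restrict-∙ d (s i′) (t j′))))))
    (Equivalence.from (s∙t∈A⇔≤ i j) i≤j))

theorem1p3 : ∃[ c ] ∃[ C ] (0ℚ < c × 0ℚ < C ×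
    (∀ (N : ℕ) .{{_ : NonZero N}}
    (A : Pred (AbelianGroup.Carrier 𝔽₂^∞) 0ℓ) →
    A Respects (AbelianGroup._≈_ 𝔽₂^∞) →
    HasSize (AbelianGroup.setoid 𝔽₂^∞) A N →
    ∀ (k : ℕ) .{{_ : NonZero k}} →
    k ≥[ C · N ^ (1ℚ - c) ] →
    Stable 𝔽₂^∞ k A))
theorem1p3 =
  -- The value c = 1/85 comes from n^85 = O(N^84). For C it suffices to exceed 2 and 5 times the
  -- 85th root of the constant in `order-bound`; 100 is ample.
  ℤ.+ 1 ℚ./ 85 , ℤ.+ 100 ℚ./ 1 , from-yes (0ℚ ℚ.<? ℤ.+ 1 ℚ./ 85) , from-yes (0ℚ ℚ.<? ℤ.+ 100 ℚ./ 1) ,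
  λ N A resp size k large order →
    order-bound-contradiction 85 84 (16 ^ 12 * (8 ^ 12 * 6 ^ 13)) 100
      (from-yes (2 ^ 85 ℕ.<? 100 ^ 85))
      (from-yes (16 ^ 12 * (8 ^ 12 * 6 ^ 13) * 5 ^ 85 ℕ.<? 100 ^ 85))
      -- In lowest terms 1 - c is 84/85, so the hypothesis on k reads k^85 ≥ 100^85 · N^84.
      (power-inequality k 100 (N ^ 84) 85 large)
      λ n 3n≤k → order-property-bound A resp size order 3n≤k
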